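{- $\{c_{pqr}(k):\ 3\le p<q<r \text{ primes},\ k\ge 0\}=\mathbb Z$, where $c_{pqr}(k)$ is the coefficient of $x^k$ in $\Psi_{pqr}(x)$.
   Context: $\Phi_n(x)$ is the $n$-th cyclotomic polynomial and $\Psi_n(x)=(x^n-1)/\Phi_n(x)=\sum_k c_n(k)x^k\in\mathbb Z[x]$, with $c_n(k)=0$ for $k>n-\varphi(n)$. -}

module Defs where

open import Data.Nat using (ℕ; zero; suc; _≤ᵇ_)
open import Data.Nat.Divisibility using (_∣?_)
open import Data.Integer using (ℤ; +_; -[1+_]; _+_; _-_; _*_)
open import Data.List using (List; []; _∷_; _++_; [_]; length; reverse; foldr; replicate; zip; upTo)
open import Data.Bool using (if_then_else_)
open import Data.Product using (_,_)
open import Relation.Nullary.Decidable using (does)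

-- Integer polynomials as coefficient lists, lowest degree first:
-- the list a₀ ∷ a₁ ∷ … ∷ aₘ ∷ [] denotes a₀ + a₁ x + … + aₘ xᵐ.
Poly : Set
Poly = List ℤ

coeff : Poly → ℕ → ℤ
coeff []       _       = + 0
coeff (a ∷ f)  zero    = a
coeff (a ∷ f)  (suc k) = coeff f k

infixl 6 _+P_
infixl 7 _*P_

_+P_ : Poly → Poly → Poly
[]      +P g       = g
(a ∷ f) +P []      = a ∷ f
(a ∷ f) +P (b ∷ g) = (a + b) ∷ (f +P g)

scaleP : ℤ → Poly → Poly
scaleP c []      = []
scaleP c (a ∷ f) = (c * a) ∷ scaleP c f

_*P_ : Poly → Poly → Poly
[]      *P g = []
(a ∷ f) *P g = scaleP a g +P (+ 0 ∷ (f *P g))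

oneP : Poly
oneP = + 1 ∷ []

xⁿ-1 : ℕ → Poly
xⁿ-1 zero    = []
xⁿ-1 (suc m) = -[1+ 0 ] ∷ (replicate m (+ 0) ++ [ + 1 ])

isZero : ℤ → Data.Bool.Bool
isZero (+ zero) = Data.Bool.true
isZero _        = Data.Bool.false

stripHL : List ℤ → List ℤ       -- on high-to-low lists: drop leading zeros
stripHL []      = []
stripHL (a ∷ f) = if isZero a then stripHL f else a ∷ f

-- Long division, on coefficient lists written highest degree first,
-- by a monic divisor  1 ∷ g'  (g' = remaining coefficients, high to low).
subLead : ℤ → List ℤ → List ℤ → List ℤ
subLead a []      f       = f
subLead a (b ∷ g) []      = []
subLead a (b ∷ g) (c ∷ f) = (c - a * b) ∷ subLead a g f

divHL : ℕ → List ℤ → List ℤ → List ℤ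
divHL zero    g' f       = []
divHL (suc n) g' []      = []
divHL (suc n) g' (a ∷ f) =
  if length g' ≤ᵇ length f
  then a ∷ divHL n g' (subLead a g' f)
  else []

-- Quotient of f by a monic polynomial g in ℤ[x] (Euclidean long division).
-- (Only ever applied to monic g; the leading coefficient of g is taken to be 1.)
_÷P_ : Poly → Poly → Poly
f ÷P g with stripHL (reverse g)
... | []      = []
... | _ ∷ g'  = reverse (divHL (length f) g' (reverse f))

-- Cyclotomic polynomials, via  x^n - 1 = ∏_{d ∣ n} Φ_d(x), i.e.
--   Φ_n = (x^n - 1) / ∏_{d ∣ n, d < n} Φ_d .
-- stepΦ n ps  computes Φ_n from ps = [Φ_1, …, Φ_{n-1}].
properProd : ℕ → List Poly → Poly
properProd n ps =
  foldr (λ { (i , p) acc → if does (suc i ∣? n) then p *P acc else acc })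
        oneP (zip (upTo (Data.List.length ps)) ps)

stepΦ : ℕ → List Poly → Poly
stepΦ n ps = xⁿ-1 n ÷P properProd n ps

cyclotomicList : ℕ → List Poly
cyclotomicList zero    = []
cyclotomicList (suc n) = cyclotomicList n ++ [ stepΦ (suc n) (cyclotomicList n) ]

-- Φ_n (for n ≥ 1; Φ_0 is a meaningless placeholder)
Φ : ℕ → Poly
Φ zero    = []
Φ (suc n) = stepΦ (suc n) (cyclotomicList n)

Ψ : ℕ → Poly
Ψ n = xⁿ-1 n ÷P Φ n

c : ℕ → ℕ → ℤ
c n k = coeff (Ψ n) k

{-# OPTIONS --safe #-}
module Submission where

open import Defs
open import Data.Nat using (ℕ; _≤_; _<_; _*_)
open import Data.Nat.Primality using (Prime)
open import Data.Integer using (ℤ)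
open import Data.Product using (Σ; _×_)
open import Relation.Binary.PropositionalEquality using (_≡_)

open import Algebra.Bundles using (CommutativeRing)
open import Data.Bool using (true; false; T; if_then_else_)
open import Data.Fin using (Fin; toℕ)
import Data.Fin.Properties as Fin
import Data.Integer as ℤ
import Data.Integer.Properties as ℤ
open import Data.Integer.Tactic.RingSolver using (solve-∀)
open import Data.List using (List; []; _∷_; _++_; [_]; replicate; length; reverse; map; filter; foldr; zip; upTo; lookup)
import Data.List.Properties as List
open import Data.List.Membership.Propositional using (_∈_)
open import Data.List.Membership.Propositional.Properties using (∈-map⁺; ∈-map⁻; ∈-++⁺ˡ; ∈-++⁺ʳ; ∈-++⁻; ∈-filter⁺; ∈-filter⁻; ∈-upTo⁺; ∈-upTo⁻)
open import Data.List.Membership.Propositional.Properties.WithK using (unique∧set⇒bag)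
open import Data.List.Relation.Binary.BagAndSetEquality using (∼bag⇒↭)
open import Data.List.Relation.Binary.Permutation.Propositional as ↭ using (_↭_)
import Data.List.Relation.Binary.Permutation.Propositional.Properties as ↭
open import Data.List.Relation.Unary.All as All using (All; []; _∷_)
open import Data.List.Relation.Unary.AllPairs using ([]; _∷_)
open import Data.List.Relation.Unary.Any using (here; there; index)
import Data.List.Relation.Unary.Any.Properties as Any
open import Data.List.Relation.Unary.Unique.Propositional using (Unique)
import Data.List.Relation.Unary.Unique.Propositional.Properties as Unique
open import Data.Maybe using (Maybe; just; nothing)
open import Data.Nat using (zero; suc; _+_; _∸_; _^_; _≤ᵇ_; z≤n; s≤s; NonZero)
import Data.Nat as ℕ
import Data.Nat.Properties as ℕ
open import Data.Nat.Coprimality using (Coprime; coprime-Bézout)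
import Data.Nat.Coprimality as Coprime
open import Data.Nat.DivMod using (_/_; _%_; m≡m%n+[m/n]*n; m/n*n≤m; m%n<n; /-monoˡ-≤; m*n/n≡m)
open import Data.Nat.Divisibility using (_∣_; _∣?_; divides; ∣⇒≤; ∣-refl; ∣-trans; ∣1⇒≡1; m∣m*n; n∣m*n; ∣m+n∣m⇒∣n; *-monoʳ-∣; *-cancelˡ-∣)
open import Data.Nat.GCD using (module Bézout)
open import Data.Nat.ListAction using (product)
open import Data.Nat.Primality using (prime?; euclidsLemma; prime⇒nonZero; prime⇒nonTrivial; prime⇒irreducible; ¬prime[0]; ¬prime[1])
open import Data.Nat.Primality.Factorisation using (factorise)
open import Data.Nat.Tactic.RingSolver using () renaming (solve-∀ to ℕ-solve-∀)
open import Data.Product using (∃; _,_; proj₁; proj₂)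
open import Data.Sum using (_⊎_; inj₁; inj₂; fromInj₁)
open import Function using (_∘_; mk⇔)
open import Level using (0ℓ)
open import Relation.Binary.Definitions using (tri<; tri≈; tri>)
open import Relation.Binary.PropositionalEquality using (_≢_; refl; sym; trans; cong; cong₂; subst; module ≡-Reasoning)
import Relation.Binary.Reasoning.Setoid
open import Relation.Nullary using (¬_; yes; no; contradiction; does; _×-dec_)
open import Tactic.RingSolver.Core.AlmostCommutativeRing using (AlmostCommutativeRing; fromCommutativeRing)

-- For primes p < q < r one has Ψ_pqr = (x^qr - 1) R with (x^p - 1) R = (x - 1) Σ_{s,b<p} x^(sr+bq),
-- so below pq the k-th coefficient of R is M(k) - M(k - 1), where M(k) counts the representations
-- k = sr + bq + ap with s, b < p. Let r = q + ep with m(r - q) < q, and let wq = 1 + vp with w < p.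
-- The representations of a given k with s + b = β need k ≡ βq mod p and start at βq, βq + (r - q), …
-- Hence k = (w + m)q has one representation (if w + m < p) while k - 1 = mq + vp has m + 1, and
-- k = (m - 1)r has m representations while k - 1 has none (if w ≥ m). For p ≥ 2m one of these
-- applies, and both signs of ±m occur because R enters Ψ_pqr once as -R and once as x^qr R.
-- Two primes q < r congruent mod p and so close exist because otherwise the sum of the
-- reciprocals of the primes would converge.

-- The ring ℤ[x]

-- The primes q and r come from a counting argument that gives no hold on the residue class of q
-- modulo p: only r ≡ q mod p is known, and w, the inverse of q, may be any residue. This is why two
-- candidate degrees are needed, one for w + m < p and one for w + m ≥ p. The closeness m(r - q) < q
-- puts the starting points βq + s(r - q) with s ≤ m into one interval of length q, so that all
-- representations with s + b = β are present before those with s + b = β + 1 could begin. The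
-- condition p ≥ 14 has another source. Φ_pqr is given by long division, and Ψ_pqr is obtained by
-- exchanging divisor and quotient. For this the product of the Φ_d over the seven proper divisors d
-- may have degree at most half of pqr. Each factor has degree at most qr, and 2 · 7 = 14.

infix 4 _≈_

-- Coefficient lists may end in zeros, so polynomials are compared by their coefficients and not as
-- lists. The record wrapper lets `f` and `g` be inferred from a proof.
record _≈_ (f g : Poly) : Set where
  constructor coeffwise
  field at : ∀ k → coeff f k ≡ coeff g k
open _≈_

≈-refl : ∀ {f} → f ≈ f
≈-refl .at k = refl

≈-sym : ∀ {f g} → f ≈ g → g ≈ f
≈-sym e .at k = sym (at e k)

≈-trans : ∀ {f g h} → f ≈ g → g ≈ h → f ≈ h
≈-trans e d .at k = trans (at e k) (at d k)

coeff-+ : ∀ f g k → coeff (f +P g) k ≡ coeff f k ℤ.+ coeff g k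
coeff-+ []      g       k       = sym (ℤ.+-identityˡ _)
coeff-+ (a ∷ f) []      k       = sym (ℤ.+-identityʳ _)
coeff-+ (a ∷ f) (b ∷ g) zero    = refl
coeff-+ (a ∷ f) (b ∷ g) (suc k) = coeff-+ f g k

coeff-scale : ∀ a f k → coeff (scaleP a f) k ≡ a ℤ.* coeff f k
coeff-scale a []      k       = sym (ℤ.*-zeroʳ a)
coeff-scale a (b ∷ f) zero    = refl
coeff-scale a (b ∷ f) (suc k) = coeff-scale a f k

coeff-* : ∀ a f g k → coeff ((a ∷ f) *P g) k ≡ a ℤ.* coeff g k ℤ.+ coeff (ℤ.0ℤ ∷ f *P g) k
coeff-* a f g k = trans (coeff-+ (scaleP a g) _ k) (cong (ℤ._+ _) (coeff-scale a g k))

+P-cong : ∀ {f g h i} → f ≈ g → h ≈ i → f +P h ≈ g +P i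
+P-cong {f} {g} {h} {i} e d .at k =
  trans (coeff-+ f h k) (trans (cong₂ ℤ._+_ (at e k) (at d k)) (sym (coeff-+ g i k)))

+P-congʳ : ∀ f {g h} → g ≈ h → f +P g ≈ f +P h
+P-congʳ f e = +P-cong (≈-refl {f}) e

+P-congˡ : ∀ h {f g} → f ≈ g → f +P h ≈ g +P h
+P-congˡ h e = +P-cong e (≈-refl {h})

∷-cong : ∀ {a b f g} → a ≡ b → f ≈ g → a ∷ f ≈ b ∷ g
∷-cong e d .at zero    = e
∷-cong e d .at (suc k) = at d k

scaleP-cong : ∀ a {f g} → f ≈ g → scaleP a f ≈ scaleP a g
scaleP-cong a {f} {g} e .at k =
  trans (coeff-scale a f k) (trans (cong (a ℤ.*_) (at e k)) (sym (coeff-scale a g k)))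

*P-congʳ : ∀ f {g h} → g ≈ h → f *P g ≈ f *P h
*P-congʳ []      e = ≈-refl
*P-congʳ (a ∷ f) e = +P-cong (scaleP-cong a e) (∷-cong refl (*P-congʳ f e))

*P-zeroʳ : ∀ f → f *P [] ≈ []
*P-zeroʳ []      = ≈-refl
*P-zeroʳ (a ∷ f) .at zero    = refl
*P-zeroʳ (a ∷ f) .at (suc k) = at (*P-zeroʳ f) k

-- `_*P_` recurses on its left factor; with this mirror image for the right factor, commutativity
-- becomes an induction.
*P-∷ʳ : ∀ f b g → f *P (b ∷ g) ≈ scaleP b f +P (ℤ.0ℤ ∷ f *P g)
*P-∷ʳ []      b g .at zero    = refl
*P-∷ʳ []      b g .at (suc k) = refl
*P-∷ʳ (a ∷ f) b g .at zero    = cong (ℤ._+ ℤ.0ℤ) (ℤ.*-comm a b)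
*P-∷ʳ (a ∷ f) b g .at (suc k) = begin
  coeff (scaleP a g +P f *P (b ∷ g)) k                          ≡⟨ coeff-+ (scaleP a g) _ k ⟩
  s ℤ.+ coeff (f *P (b ∷ g)) k                                  ≡⟨ cong (λ t → s ℤ.+ t) (at (*P-∷ʳ f b g) k) ⟩
  s ℤ.+ coeff (scaleP b f +P (ℤ.0ℤ ∷ f *P g)) k                 ≡⟨ cong (λ t → s ℤ.+ t) (coeff-+ (scaleP b f) _ k) ⟩
  s ℤ.+ (u ℤ.+ v)                                               ≡⟨ swap s u v ⟩
  u ℤ.+ (s ℤ.+ v)                                               ≡⟨ cong (λ t → u ℤ.+ t) (sym (coeff-+ (scaleP a g) _ k)) ⟩
  u ℤ.+ coeff (scaleP a g +P (ℤ.0ℤ ∷ f *P g)) k                 ≡⟨ sym (coeff-+ (scaleP b f) _ k) ⟩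
  coeff (scaleP b f +P (scaleP a g +P (ℤ.0ℤ ∷ f *P g))) k       ∎
  where
  open ≡-Reasoning
  s = coeff (scaleP a g) k
  u = coeff (scaleP b f) k
  v = coeff (ℤ.0ℤ ∷ f *P g) k
  swap : ∀ x y z → x ℤ.+ (y ℤ.+ z) ≡ y ℤ.+ (x ℤ.+ z)
  swap = solve-∀

*P-comm : ∀ f g → f *P g ≈ g *P f
*P-comm []      g = ≈-sym (*P-zeroʳ g)
*P-comm (a ∷ f) g =
  ≈-trans (+P-cong ≈-refl (∷-cong refl (*P-comm f g))) (≈-sym (*P-∷ʳ g a f))

*P-cong : ∀ {f g h i} → f ≈ g → h ≈ i → f *P h ≈ g *P i
*P-cong {f} {g} {h} {i} e d =
  ≈-trans (*P-congʳ f d) (≈-trans (*P-comm f i) (≈-trans (*P-congʳ i e) (*P-comm i g)))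

+P-assoc : ∀ f g h → (f +P g) +P h ≈ f +P (g +P h)
+P-assoc f g h .at k = begin
  coeff ((f +P g) +P h) k                       ≡⟨ coeff-+ (f +P g) h k ⟩
  coeff (f +P g) k ℤ.+ coeff h k                ≡⟨ cong (ℤ._+ _) (coeff-+ f g k) ⟩
  coeff f k ℤ.+ coeff g k ℤ.+ coeff h k         ≡⟨ ℤ.+-assoc (coeff f k) _ _ ⟩
  coeff f k ℤ.+ (coeff g k ℤ.+ coeff h k)       ≡⟨ cong (λ t → coeff f k ℤ.+ t) (sym (coeff-+ g h k)) ⟩
  coeff f k ℤ.+ coeff (g +P h) k                ≡⟨ sym (coeff-+ f (g +P h) k) ⟩
  coeff (f +P (g +P h)) k                       ∎
  where open ≡-Reasoning

+P-comm : ∀ f g → f +P g ≈ g +P f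
+P-comm f g .at k =
  trans (coeff-+ f g k) (trans (ℤ.+-comm (coeff f k) _) (sym (coeff-+ g f k)))

+P-identityʳ : ∀ f → f +P [] ≈ f
+P-identityʳ []      = ≈-refl
+P-identityʳ (a ∷ f) = ≈-refl

-P_ : Poly → Poly
-P f = scaleP ℤ.-1ℤ f

coeff-neg : ∀ f k → coeff (-P f) k ≡ ℤ.- coeff f k
coeff-neg f k = trans (coeff-scale ℤ.-1ℤ f k) (ℤ.-1*i≡-i _)

+P-inverseʳ : ∀ f → f +P (-P f) ≈ []
+P-inverseʳ f .at k = trans (coeff-+ f (-P f) k)
  (trans (cong (λ t → coeff f k ℤ.+ t) (coeff-neg f k)) (ℤ.+-inverseʳ (coeff f k)))

scaleP-+P : ∀ a f g → scaleP a (f +P g) ≈ scaleP a f +P scaleP a g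
scaleP-+P a f g .at k = begin
  coeff (scaleP a (f +P g)) k                           ≡⟨ coeff-scale a (f +P g) k ⟩
  a ℤ.* coeff (f +P g) k                                ≡⟨ cong (a ℤ.*_) (coeff-+ f g k) ⟩
  a ℤ.* (coeff f k ℤ.+ coeff g k)                       ≡⟨ ℤ.*-distribˡ-+ a (coeff f k) (coeff g k) ⟩
  a ℤ.* coeff f k ℤ.+ a ℤ.* coeff g k                   ≡⟨ sym (cong₂ ℤ._+_ (coeff-scale a f k) (coeff-scale a g k)) ⟩
  coeff (scaleP a f) k ℤ.+ coeff (scaleP a g) k         ≡⟨ sym (coeff-+ (scaleP a f) _ k) ⟩
  coeff (scaleP a f +P scaleP a g) k                    ∎
  where open ≡-Reasoning

scaleP-scaleP : ∀ a b f → scaleP (a ℤ.* b) f ≈ scaleP a (scaleP b f)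
scaleP-scaleP a b f .at k = trans (coeff-scale _ f k) (trans (ℤ.*-assoc a b _)
  (trans (cong (a ℤ.*_) (sym (coeff-scale b f k))) (sym (coeff-scale a (scaleP b f) k))))

+P-interchange : ∀ f g h i → (f +P g) +P (h +P i) ≈ (f +P h) +P (g +P i)
+P-interchange f g h i .at k = begin
  coeff ((f +P g) +P (h +P i)) k                                      ≡⟨ coeff-+ (f +P g) (h +P i) k ⟩
  coeff (f +P g) k ℤ.+ coeff (h +P i) k                               ≡⟨ cong₂ ℤ._+_ (coeff-+ f g k) (coeff-+ h i k) ⟩
  coeff f k ℤ.+ coeff g k ℤ.+ (coeff h k ℤ.+ coeff i k)               ≡⟨ swap (coeff f k) _ _ _ ⟩
  coeff f k ℤ.+ coeff h k ℤ.+ (coeff g k ℤ.+ coeff i k)               ≡⟨ sym (cong₂ ℤ._+_ (coeff-+ f h k) (coeff-+ g i k)) ⟩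
  coeff (f +P h) k ℤ.+ coeff (g +P i) k                               ≡⟨ sym (coeff-+ (f +P h) (g +P i) k) ⟩
  coeff ((f +P h) +P (g +P i)) k                                      ∎
  where
  open ≡-Reasoning
  swap : ∀ x y z t → x ℤ.+ y ℤ.+ (z ℤ.+ t) ≡ x ℤ.+ z ℤ.+ (y ℤ.+ t)
  swap = solve-∀

*P-distribˡ : ∀ f g h → f *P (g +P h) ≈ f *P g +P f *P h
*P-distribˡ []      g h = ≈-refl
*P-distribˡ (a ∷ f) g h =
  ≈-trans (+P-cong (scaleP-+P a g h) (∷-cong refl (*P-distribˡ f g h)))
          (+P-interchange (scaleP a g) (scaleP a h) (ℤ.0ℤ ∷ f *P g) (ℤ.0ℤ ∷ f *P h))

*P-distribʳ : ∀ f g h → (g +P h) *P f ≈ g *P f +P h *P f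
*P-distribʳ f g h = ≈-trans (*P-comm (g +P h) f)
  (≈-trans (*P-distribˡ f g h) (+P-cong (*P-comm f g) (*P-comm f h)))

scaleP-*P : ∀ a f g → scaleP a f *P g ≈ scaleP a (f *P g)
scaleP-*P a []      g = ≈-refl
scaleP-*P a (b ∷ f) g = ≈-trans
  (+P-cong (scaleP-scaleP a b g) (∷-cong (sym (ℤ.*-zeroʳ a)) (scaleP-*P a f g)))
  (≈-sym (scaleP-+P a (scaleP b g) (ℤ.0ℤ ∷ f *P g)))

scaleP-zero : ∀ f → scaleP ℤ.0ℤ f ≈ []
scaleP-zero f .at k = coeff-scale ℤ.0ℤ f k

0∷-*P : ∀ f g → (ℤ.0ℤ ∷ f) *P g ≈ ℤ.0ℤ ∷ f *P g
0∷-*P f g = +P-cong (scaleP-zero g) ≈-refl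

*P-assoc : ∀ f g h → (f *P g) *P h ≈ f *P (g *P h)
*P-assoc []      g h = ≈-refl
*P-assoc (a ∷ f) g h = ≈-trans (*P-distribʳ h (scaleP a g) (ℤ.0ℤ ∷ f *P g))
  (+P-cong (scaleP-*P a g h) (≈-trans (0∷-*P (f *P g) h) (∷-cong refl (*P-assoc f g h))))

*P-identityˡ : ∀ f → oneP *P f ≈ f
*P-identityˡ f .at k = trans (coeff-* ℤ.1ℤ [] f k)
  (trans (cong₂ ℤ._+_ (ℤ.*-identityˡ (coeff f k)) (zeros k)) (ℤ.+-identityʳ _))
  where
  zeros : ∀ k → coeff (ℤ.0ℤ ∷ []) k ≡ ℤ.0ℤ
  zeros zero    = refl
  zeros (suc k) = refl

*P-identityʳ : ∀ f → f *P oneP ≈ f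
*P-identityʳ f = ≈-trans (*P-comm f oneP) (*P-identityˡ f)

polyRing : CommutativeRing 0ℓ 0ℓ
polyRing = record
  { Carrier = Poly ; _≈_ = _≈_ ; _+_ = _+P_ ; _*_ = _*P_ ; -_ = -P_ ; 0# = [] ; 1# = oneP
  ; isCommutativeRing = record
    { isRing = record
      { +-isAbelianGroup = record
        { isGroup = record
          { isMonoid = record
            { isSemigroup = record
              { isMagma = record
                { isEquivalence = record { refl = ≈-refl ; sym = ≈-sym ; trans = ≈-trans }
                ; ∙-cong = +P-cong }
              ; assoc = +P-assoc }
            ; identity = (λ f → ≈-refl) , +P-identityʳ }
          ; inverse = (λ f → ≈-trans (+P-comm (-P f) f) (+P-inverseʳ f)) , +P-inverseʳ
          ; ⁻¹-cong = scaleP-cong ℤ.-1ℤ }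
        ; comm = +P-comm }
      ; *-cong = *P-cong
      ; *-assoc = *P-assoc
      ; *-identity = *P-identityˡ , *P-identityʳ
      ; distrib = *P-distribˡ , *P-distribʳ }
    ; *-comm = *P-comm } }

isZeroP : (f : Poly) → Maybe ([] ≈ f)
isZeroP [] = just ≈-refl
isZeroP (ℤ.+0 ∷ f) with isZeroP f
... | just e  = just (coeffwise λ { zero → refl ; (suc k) → at e k })
... | nothing = nothing
isZeroP (_ ∷ f) = nothing

polyACR : AlmostCommutativeRing _ _
polyACR = fromCommutativeRing polyRing isZeroP

open import Tactic.RingSolver.NonReflective polyACR
  using (solve; _⊕_; _⊗_; ⊝_; Κ)
open CommutativeRing polyRing using () renaming (setoid to polySetoid)
module ≈-Reasoning = Relation.Binary.Reasoning.Setoid polySetoid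

-- Powers of x, the binomials x^n - 1 and geometric sums

X : ℕ → Poly
X zero    = oneP
X (suc n) = ℤ.0ℤ ∷ X n

D : ℕ → Poly
D n = X n +P (-P oneP)

-- The quotient (x^(nm) - 1)/(x^m - 1) for m > 0. For a prime n the case m = 1, called `G n` below,
-- is Φ_n.
E : ℕ → ℕ → Poly
E zero    m = []
E (suc n) m = E n m +P X (n * m)

G : ℕ → Poly
G n = E n 1

≈-reflexive : ∀ {f g} → f ≡ g → f ≈ g
≈-reflexive refl = ≈-refl

X-*P : ∀ n f → X (suc n) *P f ≈ ℤ.0ℤ ∷ X n *P f
X-*P n f = 0∷-*P (X n) f

X-+ : ∀ m n → X (m + n) ≈ X m *P X n
X-+ zero    n = ≈-sym (*P-identityˡ (X n))
X-+ (suc m) n = ≈-trans (∷-cong refl (X-+ m n)) (≈-sym (X-*P m (X n)))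

coeff-X*-≥ : ∀ d f k → coeff (X d *P f) (d + k) ≡ coeff f k
coeff-X*-≥ zero    f k = at (*P-identityˡ f) k
coeff-X*-≥ (suc d) f k = trans (at (X-*P d f) (suc (d + k))) (coeff-X*-≥ d f k)

coeff-X*-< : ∀ d f {k} → k < d → coeff (X d *P f) k ≡ ℤ.0ℤ
coeff-X*-< (suc d) f {zero}  _         = at (X-*P d f) zero
coeff-X*-< (suc d) f {suc k} (s≤s k<d) = trans (at (X-*P d f) (suc k)) (coeff-X*-< d f k<d)

-- Quantifying over all i with d + i = k avoids truncated subtraction: for k < d the hypothesis is
-- vacuous.
coeff-X*-vanish : ∀ d f k → (∀ i → d + i ≡ k → coeff f i ≡ ℤ.0ℤ) → coeff (X d *P f) k ≡ ℤ.0ℤ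
coeff-X*-vanish d f k h with d ℕ.≤? k
... | no  d≰k = coeff-X*-< d f (ℕ.≰⇒> d≰k)
... | yes d≤k = subst (λ t → coeff (X d *P f) t ≡ ℤ.0ℤ) (ℕ.m+[n∸m]≡n d≤k)
                  (trans (coeff-X*-≥ d f (k ∸ d)) (h (k ∸ d) (ℕ.m+[n∸m]≡n d≤k)))

coeff-X-same : ∀ n → coeff (X n) n ≡ ℤ.1ℤ
coeff-X-same zero    = refl
coeff-X-same (suc n) = coeff-X-same n

coeff-X-diff : ∀ n {k} → k ≢ n → coeff (X n) k ≡ ℤ.0ℤ
coeff-X-diff zero    {zero}  k≢n = contradiction refl k≢n
coeff-X-diff zero    {suc k} k≢n = refl
coeff-X-diff (suc n) {zero}  k≢n = refl
coeff-X-diff (suc n) {suc k} k≢n = coeff-X-diff n (λ e → k≢n (cong suc e))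

G-+ : ∀ a b → G (a + b) ≈ G a +P X a *P G b
G-+ a zero    = begin
  G (a + 0)              ≈⟨ ≈-reflexive (cong G (ℕ.+-identityʳ a)) ⟩
  G a                    ≈⟨ +P-identityʳ (G a) ⟨
  G a +P []              ≈⟨ +P-cong ≈-refl (*P-zeroʳ (X a)) ⟨
  G a +P X a *P []       ∎
  where open ≈-Reasoning
G-+ a (suc b) = begin
  G (a + suc b)                                ≈⟨ ≈-reflexive (cong G (ℕ.+-suc a b)) ⟩
  G (a + b) +P X ((a + b) * 1)                 ≈⟨ +P-cong (G-+ a b) (≈-trans (≈-reflexive (cong X (trans (ℕ.*-identityʳ (a + b)) (cong (a +_) (sym (ℕ.*-identityʳ b)))))) (X-+ a (b * 1))) ⟩
  (G a +P X a *P G b) +P X a *P X (b * 1)      ≈⟨ solve 4 (λ g x h y → g ⊕ x ⊗ h ⊕ x ⊗ y , g ⊕ x ⊗ (h ⊕ y)) ≈-refl (G a) (X a) (G b) (X (b * 1)) ⟩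
  G a +P X a *P G (suc b)                      ∎
  where open ≈-Reasoning

D-*-E : ∀ n m → D m *P E n m ≈ D (n * m)
D-*-E zero    m .at k = trans (at (*P-zeroʳ (D m)) k) (sym (at (+P-inverseʳ oneP) k))
D-*-E (suc n) m = begin
  D m *P (E n m +P X (n * m))                    ≈⟨ *P-distribˡ (D m) (E n m) (X (n * m)) ⟩
  D m *P E n m +P D m *P X (n * m)               ≈⟨ +P-cong (D-*-E n m) ≈-refl ⟩
  D (n * m) +P D m *P X (n * m)                  ≈⟨ solve 2 (λ x y → y ⊕ ⊝ Κ oneP ⊕ (x ⊕ ⊝ Κ oneP) ⊗ y , x ⊗ y ⊕ ⊝ Κ oneP) ≈-refl (X m) (X (n * m)) ⟩
  X m *P X (n * m) +P (-P oneP)                  ≈⟨ +P-cong (≈-sym (X-+ m (n * m))) ≈-refl ⟩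
  D (suc n * m)                                  ∎
  where open ≈-Reasoning

D₁-*-G : ∀ n → D 1 *P G n ≈ D n
D₁-*-G n = ≈-trans (D-*-E n 1) (≈-reflexive (cong D (ℕ.*-identityʳ n)))

G-* : ∀ n m → G (n * m) ≈ G m *P E n m
G-* zero    m = ≈-sym (*P-zeroʳ (G m))
G-* (suc n) m = begin
  G (m + n * m)                            ≈⟨ ≈-reflexive (cong G (ℕ.+-comm m (n * m))) ⟩
  G (n * m + m)                            ≈⟨ G-+ (n * m) m ⟩
  G (n * m) +P X (n * m) *P G m            ≈⟨ +P-cong (G-* n m) (*P-comm (X (n * m)) (G m)) ⟩
  G m *P E n m +P G m *P X (n * m)         ≈⟨ *P-distribˡ (G m) (E n m) (X (n * m)) ⟨
  G m *P E (suc n) m                       ∎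
  where open ≈-Reasoning

-- An identity ap = 1 + bq lifts to polynomials: G(ap) is a multiple of G(p), G(bq) is one of G(q),
-- and G(1 + bq) = 1 + x G(bq). Thus G(p) and G(q) generate the unit ideal over ℤ itself.
G-bezout : ∀ {p q} → Coprime p q → Σ Poly λ f → Σ Poly λ g → f *P G p +P g *P G q ≈ oneP
G-bezout {p} {q} cop with coprime-Bézout cop
... | Bézout.Identity.+- a b eq = E a p , (-P (X 1 *P E b q)) , bezout
  where
  open ≈-Reasoning
  bezout : E a p *P G p +P (-P (X 1 *P E b q)) *P G q ≈ oneP
  bezout = begin
    E a p *P G p +P (-P (X 1 *P E b q)) *P G q
      ≈⟨ solve 5 (λ e g x d h → e ⊗ g ⊕ (⊝ (x ⊗ d)) ⊗ h , g ⊗ e ⊕ ⊝ (x ⊗ (h ⊗ d))) ≈-refl (E a p) (G p) (X 1) (E b q) (G q) ⟩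
    G p *P E a p +P (-P (X 1 *P (G q *P E b q)))
      ≈⟨ +P-cong (≈-sym (G-* a p)) (scaleP-cong ℤ.-1ℤ (*P-congʳ (X 1) (≈-sym (G-* b q)))) ⟩
    G (a * p) +P (-P (X 1 *P G (b * q)))
      ≈⟨ +P-cong (≈-reflexive (cong G (sym eq))) ≈-refl ⟩
    G (1 + b * q) +P (-P (X 1 *P G (b * q)))
      ≈⟨ +P-cong (G-+ 1 (b * q)) ≈-refl ⟩
    (oneP +P X 1 *P G (b * q)) +P (-P (X 1 *P G (b * q)))
      ≈⟨ solve 1 (λ y → Κ oneP ⊕ y ⊕ ⊝ y , Κ oneP) ≈-refl (X 1 *P G (b * q)) ⟩
    oneP ∎
... | Bézout.Identity.-+ a b eq = (-P (X 1 *P E a p)) , E b q , bezout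
  where
  open ≈-Reasoning
  bezout : (-P (X 1 *P E a p)) *P G p +P E b q *P G q ≈ oneP
  bezout = begin
    (-P (X 1 *P E a p)) *P G p +P E b q *P G q
      ≈⟨ solve 5 (λ e g x d h → (⊝ (x ⊗ e)) ⊗ g ⊕ d ⊗ h , h ⊗ d ⊕ ⊝ (x ⊗ (g ⊗ e))) ≈-refl (E a p) (G p) (X 1) (E b q) (G q) ⟩
    G q *P E b q +P (-P (X 1 *P (G p *P E a p)))
      ≈⟨ +P-cong (≈-sym (G-* b q)) (scaleP-cong ℤ.-1ℤ (*P-congʳ (X 1) (≈-sym (G-* a p)))) ⟩
    G (b * q) +P (-P (X 1 *P G (a * p)))
      ≈⟨ +P-cong (≈-reflexive (cong G (sym eq))) ≈-refl ⟩
    G (1 + a * p) +P (-P (X 1 *P G (a * p)))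
      ≈⟨ +P-cong (G-+ 1 (a * p)) ≈-refl ⟩
    (oneP +P X 1 *P G (a * p)) +P (-P (X 1 *P G (a * p)))
      ≈⟨ solve 1 (λ y → Κ oneP ⊕ y ⊕ ⊝ y , Κ oneP) ≈-refl (X 1 *P G (a * p)) ⟩
    oneP ∎

-- cof plays the role of Φ_pq.
record Cofactor (p q : ℕ) : Set where
  field
    cof      : Poly
    cof-*-Gp : cof *P G p ≈ E p q
    cof-*-Gq : cof *P G q ≈ E q p
open Cofactor

-- Φ_pq is both E(p,q)/G(p) and E(q,p)/G(q). Since G(p) E(q,p) = G(pq) = G(q) E(p,q), combining the
-- two numerators with the Bézout coefficients gives a polynomial with both properties, and no
-- division is carried out.
cofactor : ∀ {p q} → Coprime p q → Cofactor p q
cofactor {p} {q} cop = let f , g , e = G-bezout cop in record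
  { cof = f *P E p q +P g *P E q p
  ; cof-*-Gp = begin
      (f *P E p q +P g *P E q p) *P G p
        ≈⟨ solve 5 (λ f g u v x → (f ⊗ u ⊕ g ⊗ v) ⊗ x , f ⊗ u ⊗ x ⊕ g ⊗ (x ⊗ v)) ≈-refl f g (E p q) (E q p) (G p) ⟩
      f *P E p q *P G p +P g *P (G p *P E q p)
        ≈⟨ +P-cong ≈-refl (*P-congʳ g GE) ⟩
      f *P E p q *P G p +P g *P (G q *P E p q)
        ≈⟨ solve 5 (λ f g u x y → f ⊗ u ⊗ x ⊕ g ⊗ (y ⊗ u) , (f ⊗ x ⊕ g ⊗ y) ⊗ u) ≈-refl f g (E p q) (G p) (G q) ⟩
      (f *P G p +P g *P G q) *P E p q
        ≈⟨ *P-cong e ≈-refl ⟩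
      oneP *P E p q
        ≈⟨ *P-identityˡ (E p q) ⟩
      E p q ∎
  ; cof-*-Gq = begin
      (f *P E p q +P g *P E q p) *P G q
        ≈⟨ solve 5 (λ f g u v x → (f ⊗ u ⊕ g ⊗ v) ⊗ x , f ⊗ (x ⊗ u) ⊕ g ⊗ v ⊗ x) ≈-refl f g (E p q) (E q p) (G q) ⟩
      f *P (G q *P E p q) +P g *P E q p *P G q
        ≈⟨ +P-cong (*P-congʳ f (≈-sym GE)) ≈-refl ⟩
      f *P (G p *P E q p) +P g *P E q p *P G q
        ≈⟨ solve 5 (λ f g v x y → f ⊗ (x ⊗ v) ⊕ g ⊗ v ⊗ y , (f ⊗ x ⊕ g ⊗ y) ⊗ v) ≈-refl f g (E q p) (G p) (G q) ⟩
      (f *P G p +P g *P G q) *P E q p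
        ≈⟨ *P-cong e ≈-refl ⟩
      oneP *P E q p
        ≈⟨ *P-identityˡ (E q p) ⟩
      E q p ∎ }
  where
  open ≈-Reasoning
  GE : G p *P E q p ≈ G q *P E p q
  GE = ≈-trans (≈-sym (G-* q p)) (≈-trans (≈-reflexive (cong G (ℕ.*-comm q p))) (G-* p q))

-- Euclidean division

DegreeBelow : ℕ → Poly → Set
DegreeBelow d f = ∀ {k} → d ≤ k → coeff f k ≡ ℤ.0ℤ

record Monic (d : ℕ) (f : Poly) : Set where
  field
    lead  : coeff f d ≡ ℤ.1ℤ
    above : DegreeBelow (suc d) f
open Monic

degree-resp-≈ : ∀ {d f g} → f ≈ g → DegreeBelow d f → DegreeBelow d g
degree-resp-≈ e f< d≤k = trans (sym (at e _)) (f< d≤k)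

monic-resp-≈ : ∀ {d f g} → f ≈ g → Monic d f → Monic d g
monic-resp-≈ e m = record { lead = trans (sym (at e _)) (lead m) ; above = degree-resp-≈ e (above m) }

degree-mono : ∀ {d e f} → d ≤ e → DegreeBelow d f → DegreeBelow e f
degree-mono d≤e f< e≤k = f< (ℕ.≤-trans d≤e e≤k)

degree-length : ∀ f → DegreeBelow (length f) f
degree-length []      _         = refl
degree-length (a ∷ f) (s≤s l≤k) = degree-length f l≤k

degree-+ : ∀ {d f g} → DegreeBelow d f → DegreeBelow d g → DegreeBelow d (f +P g)
degree-+ {f = f} {g} f< g< {k} d≤k = trans (coeff-+ f g k) (cong₂ ℤ._+_ (f< d≤k) (g< d≤k))

degree-scale : ∀ {d f} a → DegreeBelow d f → DegreeBelow d (scaleP a f)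
degree-scale {f = f} a f< {k} d≤k =
  trans (coeff-scale a f k) (trans (cong (a ℤ.*_) (f< d≤k)) (ℤ.*-zeroʳ a))

degree0⇒≈[] : ∀ {f} → DegreeBelow 0 f → f ≈ []
degree0⇒≈[] f< .at k = f< z≤n

degree-* : ∀ {d e} f g → DegreeBelow (suc d) f → DegreeBelow (suc e) g →
           DegreeBelow (suc (d + e)) (f *P g)
degree-* []      g f< g< _ = refl
degree-* {zero} (a ∷ f) g f< g< {suc k} 1+e≤k = trans (coeff-* a f g (suc k))
  (trans (cong₂ ℤ._+_ (trans (cong (a ℤ.*_) (g< 1+e≤k)) (ℤ.*-zeroʳ a))
                      (at (*P-cong (degree0⇒≈[] {f} (λ _ → f< (s≤s z≤n))) (≈-refl {g})) k)) refl)
degree-* {suc d} {e} (a ∷ f) g f< g< {suc k} (s≤s d+e<k) = trans (coeff-* a f g (suc k))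
  (trans (cong₂ ℤ._+_ (trans (cong (a ℤ.*_) (g< (s≤s (ℕ.≤-trans (ℕ.m≤n+m e (suc d)) d+e<k)))) (ℤ.*-zeroʳ a))
                      (degree-* f g (λ d<k → f< (s≤s d<k)) g< d+e<k)) refl)

coeff-*-top : ∀ {d e} f g → DegreeBelow (suc d) f → DegreeBelow (suc e) g →
              coeff (f *P g) (d + e) ≡ coeff f d ℤ.* coeff g e
coeff-*-top []      g f< g< = refl
coeff-*-top {zero} {e} (a ∷ f) g f< g< = trans (coeff-* a f g e)
  (trans (cong (λ t → a ℤ.* coeff g e ℤ.+ t) (vanish e)) (ℤ.+-identityʳ _))
  where
  vanish : ∀ k → coeff (ℤ.0ℤ ∷ f *P g) k ≡ ℤ.0ℤ
  vanish zero    = refl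
  vanish (suc k) = at (*P-cong (degree0⇒≈[] {f} (λ _ → f< (s≤s z≤n))) (≈-refl {g})) k
coeff-*-top {suc d} {e} (a ∷ f) g f< g< = trans (coeff-* a f g (suc (d + e)))
  (trans (cong₂ ℤ._+_ (trans (cong (a ℤ.*_) (g< (s≤s (ℕ.m≤n+m e d)))) (ℤ.*-zeroʳ a))
                      (coeff-*-top f g (λ d<k → f< (s≤s d<k)) g<)) (ℤ.+-identityˡ _))

monic-* : ∀ {d e f g} → Monic d f → Monic e g → Monic (d + e) (f *P g)
monic-* {f = f} {g} mf mg = record
  { lead  = trans (coeff-*-top f g (above mf) (above mg)) (cong₂ ℤ._*_ (lead mf) (lead mg))
  ; above = degree-* f g (above mf) (above mg) }

-- If f has degree at most m, the product has in degree d + m the same coefficient as f in degree m,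
-- which must therefore vanish; descend on m. Uniqueness of quotients rests on this.
monic-*-cancel : ∀ {d} g → Monic d g → ∀ f → DegreeBelow d (g *P f) → f ≈ []
monic-*-cancel {d} g mg f gf< = bounded (length f) (degree-length f)
  where
  bounded : ∀ m → DegreeBelow m f → f ≈ []
  bounded zero    f< = degree0⇒≈[] f<
  bounded (suc m) f< = bounded m below
    where
    fm≡0 : coeff f m ≡ ℤ.0ℤ
    fm≡0 = begin
      coeff f m                      ≡⟨ ℤ.*-identityˡ _ ⟨
      ℤ.1ℤ ℤ.* coeff f m             ≡⟨ cong (ℤ._* coeff f m) (lead mg) ⟨
      coeff g d ℤ.* coeff f m        ≡⟨ coeff-*-top g f (above mg) f< ⟨
      coeff (g *P f) (d + m)         ≡⟨ gf< (ℕ.m≤m+n d m) ⟩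
      ℤ.0ℤ                           ∎
      where open ≡-Reasoning
    below : DegreeBelow m f
    below {k} m≤k with ℕ.m≤n⇒m<n∨m≡n m≤k
    ... | inj₁ m<k  = f< m<k
    ... | inj₂ refl = fm≡0

reverse-∷ : ∀ a (F : List ℤ) → reverse (a ∷ F) ≈ reverse F +P scaleP a (X (length F))
reverse-∷ a F = ≈-trans (≈-reflexive (List.unfold-reverse a F))
  (≈-trans (snoc (reverse F)) (+P-congʳ (reverse F) (scaleP-cong a (≈-reflexive (cong X (List.length-reverse F))))))
  where
  snoc : ∀ f → f ++ [ a ] ≈ f +P scaleP a (X (length f))
  snoc []      = ∷-cong (sym (ℤ.*-identityʳ a)) ≈-refl
  snoc (b ∷ f) = ∷-cong (sym (trans (cong (λ t → b ℤ.+ t) (ℤ.*-zeroʳ a)) (ℤ.+-identityʳ b))) (snoc f)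

degree-reverse : ∀ (F : List ℤ) → DegreeBelow (length F) (reverse F)
degree-reverse F = subst (λ d → DegreeBelow d (reverse F)) (List.length-reverse F) (degree-length (reverse F))

scaleP≈ : ∀ a f → scaleP a f ≈ [ a ] *P f
scaleP≈ a f .at k = trans (sym (trans (cong (λ t → coeff (scaleP a f) k ℤ.+ t) (zeros k)) (ℤ.+-identityʳ _)))
  (sym (coeff-+ (scaleP a f) _ k))
  where
  zeros : ∀ k → coeff (ℤ.0ℤ ∷ []) k ≡ ℤ.0ℤ
  zeros zero    = refl
  zeros (suc k) = refl

length-subLead : ∀ a g F → length g ≤ length F → length (subLead a g F) ≡ length F
length-subLead a []      F       _       = refl
length-subLead a (b ∷ g) (x ∷ F) (s≤s l) = cong suc (length-subLead a g F l)

-- One step of long division: `subLead` subtracts `a` times the divisor without its leading 1. It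
-- aligns the two lists at the high end, which is a shift by the difference of the lengths.
reverse-subLead : ∀ a g F → length g ≤ length F →
  reverse F ≈ reverse (subLead a g F) +P [ a ] *P (X (length F ∸ length g) *P reverse g)
reverse-subLead a []      F       _       = ≈-sym (≈-trans
  (+P-cong ≈-refl (≈-trans (*P-congʳ [ a ] (*P-zeroʳ (X (length F)))) (*P-zeroʳ [ a ])))
  (+P-identityʳ (reverse F)))
reverse-subLead a (b ∷ g) (x ∷ F) (s≤s l) = begin
  reverse (x ∷ F)
    ≈⟨ reverse-∷ x F ⟩
  reverse F +P scaleP x (X (length F))
    ≈⟨ +P-cong (reverse-subLead a g F l) splitX ⟩
  (S +P [ a ] *P (Y *P reverse g)) +P (scaleP (x ℤ.- a ℤ.* b) (X (length F)) +P [ a ] *P ([ b ] *P (Y *P X (length g))))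
    ≈⟨ solve 7 (λ s a y g t b z → (s ⊕ a ⊗ (y ⊗ g)) ⊕ (t ⊕ a ⊗ (b ⊗ (y ⊗ z))) , (s ⊕ t) ⊕ a ⊗ (y ⊗ (g ⊕ b ⊗ z))) ≈-refl
         S [ a ] Y (reverse g) (scaleP (x ℤ.- a ℤ.* b) (X (length F))) [ b ] (X (length g)) ⟩
  (S +P scaleP (x ℤ.- a ℤ.* b) (X (length F))) +P [ a ] *P (Y *P (reverse g +P [ b ] *P X (length g)))
    ≈⟨ +P-cong (+P-congʳ S (scaleP-cong (x ℤ.- a ℤ.* b) (≈-reflexive (cong X (sym (length-subLead a g F l))))))
               (*P-congʳ [ a ] (*P-congʳ Y (+P-congʳ (reverse g) (≈-sym (scaleP≈ b (X (length g))))))) ⟩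
  (S +P scaleP (x ℤ.- a ℤ.* b) (X (length (subLead a g F)))) +P [ a ] *P (Y *P (reverse g +P scaleP b (X (length g))))
    ≈⟨ +P-cong (reverse-∷ _ (subLead a g F)) (*P-congʳ [ a ] (*P-congʳ Y (reverse-∷ b g))) ⟨
  reverse (subLead a (b ∷ g) (x ∷ F)) +P [ a ] *P (Y *P reverse (b ∷ g)) ∎
  where
  open ≈-Reasoning
  S = reverse (subLead a g F)
  Y = X (length F ∸ length g)
  split : ∀ x a b t → x ℤ.* t ≡ (x ℤ.- a ℤ.* b) ℤ.* t ℤ.+ (a ℤ.* (b ℤ.* t))
  split = solve-∀
  splitX : scaleP x (X (length F)) ≈ scaleP (x ℤ.- a ℤ.* b) (X (length F)) +P [ a ] *P ([ b ] *P (Y *P X (length g)))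
  splitX = ≈-trans (coeffwise split-coeff) (+P-congʳ (scaleP (x ℤ.- a ℤ.* b) (X (length F)))
    (≈-trans (scaleP≈ a _) (*P-congʳ [ a ] (≈-trans (scaleP≈ b _) (*P-congʳ [ b ]
      (≈-trans (≈-reflexive (cong X (sym (ℕ.m∸n+n≡m l)))) (X-+ (length F ∸ length g) (length g))))))))
    where
    XF = X (length F)
    split-coeff : ∀ k → coeff (scaleP x XF) k ≡ coeff (scaleP (x ℤ.- a ℤ.* b) XF +P scaleP a (scaleP b XF)) k
    split-coeff k = trans (coeff-scale x XF k) (trans (split x a b (coeff XF k)) (sym (trans (coeff-+ (scaleP (x ℤ.- a ℤ.* b) XF) _ k)
      (cong₂ ℤ._+_ (coeff-scale (x ℤ.- a ℤ.* b) XF k) (trans (coeff-scale a (scaleP b XF) k) (cong (a ℤ.*_) (coeff-scale b XF k)))))))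

record Division (f g q : Poly) (d : ℕ) : Set where
  field
    rem     : Poly
    rem<    : DegreeBelow d rem
    equation : f ≈ g *P q +P rem

record DivisionHL (F g′ Q : List ℤ) : Set where
  field
    division : Division (reverse F) (reverse g′ +P X (length g′)) (reverse Q) (length g′)
    length-Q : length Q ≡ length F ∸ length g′

-- Here `n` is fuel, and each step shortens the dividend by one entry. The length of the quotient is
-- recorded because `monic-÷P` reads its degree bound off it.
divHL-correct : ∀ n g′ F → length F ≤ n → DivisionHL F g′ (divHL n g′ F)
divHL-correct zero    g′ []      _       = record
  { division = record { rem = [] ; rem< = λ _ → refl
      ; equation = ≈-sym (≈-trans (+P-identityʳ _) (*P-zeroʳ (reverse g′ +P X (length g′)))) }
  ; length-Q = sym (ℕ.0∸n≡0 (length g′)) }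
divHL-correct (suc n) g′ []      _       = record
  { division = record { rem = [] ; rem< = λ _ → refl
      ; equation = ≈-sym (≈-trans (+P-identityʳ _) (*P-zeroʳ (reverse g′ +P X (length g′)))) }
  ; length-Q = sym (ℕ.0∸n≡0 (length g′)) }
divHL-correct (suc n) g′ (a ∷ F) (s≤s l) with length g′ ≤ᵇ length F in eq
... | false = record
  { division = record { rem = reverse (a ∷ F)
      ; rem< = degree-mono {f = reverse (a ∷ F)} short (degree-reverse (a ∷ F))
      ; equation = ≈-sym (+P-cong (*P-zeroʳ (reverse g′ +P X (length g′))) (≈-refl {reverse (a ∷ F)})) }
  ; length-Q = sym (ℕ.m≤n⇒m∸n≡0 short) }
  where
  short : suc (length F) ≤ length g′
  short = ℕ.≰⇒> λ g≤F → subst T eq (ℕ.≤⇒≤ᵇ g≤F)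
... | true = record
  { division = record { rem = rem ; rem< = rem< ; equation = div }
  ; length-Q = trans (cong suc length-Q′) (sym (ℕ.+-∸-assoc 1 g≤F)) }
  where
  g≤F : length g′ ≤ length F
  g≤F = ℕ.≤ᵇ⇒≤ _ _ (subst T (sym eq) _)
  F′ = subLead a g′ F
  ∣F′∣ = length-subLead a g′ F g≤F
  rec = divHL-correct n g′ F′ (subst (_≤ n) (sym ∣F′∣) l)
  open DivisionHL rec
  open Division division
  Q = divHL n g′ F′
  g = reverse g′ +P X (length g′)
  e = length F ∸ length g′
  length-Q′ : length Q ≡ e
  length-Q′ = trans length-Q (cong (_∸ length g′) ∣F′∣)
  open ≈-Reasoning
  div : reverse (a ∷ F) ≈ g *P reverse (a ∷ Q) +P rem
  div = begin
    reverse (a ∷ F)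
      ≈⟨ reverse-∷ a F ⟩
    reverse F +P scaleP a (X (length F))
      ≈⟨ +P-cong (reverse-subLead a g′ F g≤F) (≈-trans (scaleP≈ a _) (*P-congʳ [ a ]
           (≈-trans (≈-reflexive (cong X (sym (ℕ.m∸n+n≡m g≤F)))) (X-+ e (length g′))))) ⟩
    (reverse F′ +P [ a ] *P (X e *P reverse g′)) +P [ a ] *P (X e *P X (length g′))
      ≈⟨ +P-cong (+P-cong equation ≈-refl) ≈-refl ⟩
    ((g *P reverse Q +P rem) +P [ a ] *P (X e *P reverse g′)) +P [ a ] *P (X e *P X (length g′))
      ≈⟨ solve 6 (λ q r a x h y → ((h ⊕ y) ⊗ q ⊕ r) ⊕ a ⊗ (x ⊗ h) ⊕ a ⊗ (x ⊗ y) , (h ⊕ y) ⊗ (q ⊕ a ⊗ x) ⊕ r) ≈-refl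
           (reverse Q) rem [ a ] (X e) (reverse g′) (X (length g′)) ⟩
    g *P (reverse Q +P [ a ] *P X e) +P rem
      ≈⟨ +P-cong (*P-congʳ g (+P-cong ≈-refl (≈-trans (≈-sym (scaleP≈ a (X e))) (scaleP-cong a (≈-reflexive (cong X (sym length-Q′))))))) ≈-refl ⟩
    g *P (reverse Q +P scaleP a (X (length Q))) +P rem
      ≈⟨ +P-cong (*P-congʳ g (reverse-∷ a Q)) ≈-refl ⟨
    g *P reverse (a ∷ Q) +P rem ∎

data Stripped (F : List ℤ) : List ℤ → Set where
  all-zero : reverse F ≈ [] → Stripped F []
  leading  : ∀ {a F′} → a ≢ ℤ.0ℤ → reverse F ≈ reverse (a ∷ F′) → Stripped F (a ∷ F′)

reverse-0∷ : ∀ F → reverse (ℤ.0ℤ ∷ F) ≈ reverse F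
reverse-0∷ F = ≈-trans (reverse-∷ ℤ.0ℤ F) (≈-trans (+P-cong ≈-refl (scaleP-zero (X (length F)))) (+P-identityʳ _))

stripHL-correct : ∀ F → Stripped F (stripHL F)
stripHL-correct []               = all-zero ≈-refl
stripHL-correct (ℤ.+0 ∷ F)       with stripHL F | stripHL-correct F
... | .[]      | all-zero e    = all-zero (≈-trans (reverse-0∷ F) e)
... | .(_ ∷ _) | leading a≢0 e = leading a≢0 (≈-trans (reverse-0∷ F) e)
stripHL-correct (ℤ.+[1+ n ] ∷ F) = leading (λ ()) ≈-refl
stripHL-correct (ℤ.-[1+ n ] ∷ F) = leading (λ ()) ≈-refl

reverse-∷-lead : ∀ a F → coeff (reverse (a ∷ F)) (length F) ≡ a
reverse-∷-lead a F = begin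
  coeff (reverse (a ∷ F)) (length F)
    ≡⟨ at (reverse-∷ a F) (length F) ⟩
  coeff (reverse F +P scaleP a (X (length F))) (length F)
    ≡⟨ coeff-+ (reverse F) _ (length F) ⟩
  coeff (reverse F) (length F) ℤ.+ coeff (scaleP a (X (length F))) (length F)
    ≡⟨ cong₂ ℤ._+_ (degree-reverse F ℕ.≤-refl) (trans (coeff-scale a (X (length F)) (length F)) (cong (a ℤ.*_) (coeff-X-same (length F)))) ⟩
  ℤ.0ℤ ℤ.+ a ℤ.* ℤ.1ℤ
    ≡⟨ trans (ℤ.+-identityˡ _) (ℤ.*-identityʳ a) ⟩
  a ∎
  where open ≡-Reasoning

-- `stripHL` only promises a nonzero first entry. Comparing degrees with the monic `g` shows that
-- this entry is the 1 which `divHL` presupposes.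
monic-reverse : ∀ {d a F g} → Monic d g → a ≢ ℤ.0ℤ → g ≈ reverse (a ∷ F) → a ≡ ℤ.1ℤ × length F ≡ d
monic-reverse {d} {a} {F} {g} mg a≢0 e with ℕ.<-cmp (length F) d
... | tri< F<d _ _ = contradiction
  (trans (sym (lead mg)) (trans (at e d) (degree-reverse (a ∷ F) F<d))) λ ()
... | tri≈ _ refl _ = trans (sym (reverse-∷-lead a F)) (trans (sym (at e d)) (lead mg)) , refl
... | tri> _ _ d<F = contradiction
  (trans (sym (reverse-∷-lead a F)) (trans (sym (at e (length F))) (above mg d<F))) a≢0

÷P-correct : ∀ f g {d} → Monic d g → Division f g (f ÷P g) d × length (f ÷P g) ≡ length f ∸ d
÷P-correct f g {d} mg with stripHL (reverse g) | stripHL-correct (reverse g)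
... | .[] | all-zero e = contradiction (trans (sym (lead mg)) (at (subst (_≈ []) (List.reverse-involutive g) e) d)) λ ()
... | .(_ ∷ _) | leading {a} {g′} a≢0 e
  with refl , refl ← monic-reverse {F = g′} mg a≢0 (subst (_≈ reverse (a ∷ g′)) (List.reverse-involutive g) e) = record
    { rem = rem ; rem< = rem<
    ; equation = ≈-trans (≈-reflexive (sym (List.reverse-involutive f))) (≈-trans equation (+P-cong (*P-cong g≈ (≈-refl {reverse Q})) ≈-refl)) }
  , trans (List.length-reverse Q) (trans length-Q (cong (_∸ length g′) (List.length-reverse f)))
  where
  Q = divHL (length f) g′ (reverse f)
  open DivisionHL (divHL-correct (length f) g′ (reverse f) (ℕ.≤-reflexive (List.length-reverse f)))
  open Division division
  g≈ : reverse g′ +P X (length g′) ≈ g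
  g≈ = ≈-sym (≈-trans (subst (_≈ reverse (ℤ.1ℤ ∷ g′)) (List.reverse-involutive g) e)
    (≈-trans (reverse-∷ ℤ.1ℤ g′) (+P-congʳ (reverse g′) (≈-trans (scaleP≈ ℤ.1ℤ X′) (*P-identityˡ X′)))))
    where X′ = X (length g′)

division-unique : ∀ {f g q q′ d} → Monic d g → Division f g q d → Division f g q′ d → q ≈ q′
division-unique {f} {g} {q} {q′} {d} mg D₁ D₂ = ≈-trans
  (solve 2 (λ q q′ → q , q ⊕ ⊝ q′ ⊕ q′) ≈-refl q q′)
  (+P-cong (monic-*-cancel g mg (q +P (-P q′)) small) ≈-refl)
  where
  module D₁ = Division D₁
  module D₂ = Division D₂
  open ≈-Reasoning
  small : DegreeBelow d (g *P (q +P (-P q′)))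
  small = degree-resp-≈ (begin
    D₂.rem +P (-P D₁.rem)
      ≈⟨ solve 3 (λ x r r′ → r′ ⊕ ⊝ r , x ⊕ r′ ⊕ ⊝ (x ⊕ r)) ≈-refl (g *P q′) D₁.rem D₂.rem ⟩
    (g *P q′ +P D₂.rem) +P (-P (g *P q′ +P D₁.rem))
      ≈⟨ +P-cong (≈-trans (≈-sym D₂.equation) D₁.equation) ≈-refl ⟩
    (g *P q +P D₁.rem) +P (-P (g *P q′ +P D₁.rem))
      ≈⟨ solve 4 (λ g q q′ r → (g ⊗ q ⊕ r) ⊕ ⊝ (g ⊗ q′ ⊕ r) , g ⊗ (q ⊕ ⊝ q′)) ≈-refl g q q′ D₁.rem ⟩
    g *P (q +P (-P q′)) ∎)
    (degree-+ {d} {D₂.rem} D₂.rem< (degree-scale {d} {D₁.rem} ℤ.-1ℤ D₁.rem<))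

÷P-unique : ∀ {f g q d} → Monic d g → Division f g q d → f ÷P g ≈ q
÷P-unique {f} {g} mg D = division-unique mg (proj₁ (÷P-correct f g mg)) D

-- Compare the coefficients of x^n in f = gq + rem; the remainder has degree below d ≤ n. Exactness
-- is not assumed, so this applies to Φ_pqr as well.
monic-÷P : ∀ {n d f g} → length f ≡ suc n → Monic n f → Monic d g → d ≤ n → Monic (n ∸ d) (f ÷P g)
monic-÷P {n} {d} {f} {g} len mf mg d≤n = record { lead = lead′ ; above = q< }
  where
  open Division (proj₁ (÷P-correct f g mg))
  q = f ÷P g
  q< : DegreeBelow (suc (n ∸ d)) q
  q< = subst (λ l → DegreeBelow l q)
    (trans (proj₂ (÷P-correct f g mg)) (trans (cong (_∸ d) len) (ℕ.+-∸-assoc 1 d≤n))) (degree-length q)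
  open ≡-Reasoning
  lead′ : coeff q (n ∸ d) ≡ ℤ.1ℤ
  lead′ = begin
    coeff q (n ∸ d)                            ≡⟨ ℤ.*-identityˡ _ ⟨
    ℤ.1ℤ ℤ.* coeff q (n ∸ d)                   ≡⟨ cong (ℤ._* coeff q (n ∸ d)) (lead mg) ⟨
    coeff g d ℤ.* coeff q (n ∸ d)              ≡⟨ coeff-*-top g q (above mg) q< ⟨
    coeff (g *P q) (d + (n ∸ d))               ≡⟨ cong (coeff (g *P q)) (ℕ.m+[n∸m]≡n d≤n) ⟩
    coeff (g *P q) n                           ≡⟨ ℤ.+-identityʳ _ ⟨
    coeff (g *P q) n ℤ.+ ℤ.0ℤ                  ≡⟨ cong (λ t → coeff (g *P q) n ℤ.+ t) (rem< d≤n) ⟨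
    coeff (g *P q) n ℤ.+ coeff rem n           ≡⟨ coeff-+ (g *P q) rem n ⟨
    coeff (g *P q +P rem) n                    ≡⟨ at equation n ⟨
    coeff f n                                  ≡⟨ lead mf ⟩
    ℤ.1ℤ                                       ∎

-- Cyclotomic polynomials of products of distinct primes

prodP : List Poly → Poly
prodP = foldr _*P_ oneP

prodP-↭ : ∀ {fs gs} → fs ↭ gs → prodP fs ≈ prodP gs
prodP-↭ ↭.refl           = ≈-refl
prodP-↭ (↭.prep f s)     = *P-congʳ f (prodP-↭ s)
prodP-↭ (↭.swap {xs = fs} f g s) = ≈-trans (*P-congʳ f (*P-congʳ g (prodP-↭ s)))
  (solve 3 (λ f g h → f ⊗ (g ⊗ h) , g ⊗ (f ⊗ h)) ≈-refl f g _)
prodP-↭ (↭.trans s t)    = ≈-trans (prodP-↭ s) (prodP-↭ t)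

cyclotomicList≡ : ∀ n → cyclotomicList n ≡ map (Φ ∘ suc) (upTo n)
cyclotomicList≡ zero    = refl
cyclotomicList≡ (suc n) = begin
  cyclotomicList n ++ [ Φ (suc n) ]                  ≡⟨ cong (_++ [ Φ (suc n) ]) (cyclotomicList≡ n) ⟩
  map (Φ ∘ suc) (upTo n) ++ [ Φ (suc n) ]            ≡⟨ List.map-++ (Φ ∘ suc) (upTo n) [ n ] ⟨
  map (Φ ∘ suc) (upTo n ++ [ n ])                    ≡⟨ cong (map (Φ ∘ suc)) (List.upTo-∷ʳ n) ⟩
  map (Φ ∘ suc) (upTo (suc n))                       ∎
  where open ≡-Reasoning

zip-map : ∀ {A B : Set} (f : A → B) xs → zip xs (map f xs) ≡ map (λ x → x , f x) xs
zip-map f []       = refl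
zip-map f (x ∷ xs) = cong ((x , f x) ∷_) (zip-map f xs)

zip-cyclotomicList : ∀ n → zip (upTo (length (cyclotomicList n))) (cyclotomicList n) ≡ map (λ i → i , Φ (suc i)) (upTo n)
zip-cyclotomicList n = begin
  zip (upTo (length (cyclotomicList n))) (cyclotomicList n)
    ≡⟨ cong (λ ps → zip (upTo (length ps)) ps) (cyclotomicList≡ n) ⟩
  zip (upTo (length (map (Φ ∘ suc) (upTo n)))) (map (Φ ∘ suc) (upTo n))
    ≡⟨ cong (λ m → zip (upTo m) (map (Φ ∘ suc) (upTo n))) (trans (List.length-map (Φ ∘ suc) (upTo n)) (List.length-upTo n)) ⟩
  zip (upTo n) (map (Φ ∘ suc) (upTo n))
    ≡⟨ zip-map (Φ ∘ suc) (upTo n) ⟩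
  map (λ i → i , Φ (suc i)) (upTo n) ∎
  where open ≡-Reasoning

-- properProd folds an anonymous pattern-matching function, so the step is a parameter here.
foldr-filter : ∀ n (step : ℕ × Poly → Poly → Poly) →
  (∀ i f acc → step (i , f) acc ≡ (if does (suc i ∣? n) then f *P acc else acc)) →
  ∀ is → foldr step oneP (map (λ i → i , Φ (suc i)) is) ≡
         prodP (map Φ (map suc (filter (λ i → suc i ∣? n) is)))
foldr-filter n step eq []       = refl
foldr-filter n step eq (i ∷ is) rewrite eq i (Φ (suc i)) (foldr step oneP (map (λ i → i , Φ (suc i)) is))
  with does (suc i ∣? n)
... | true  = cong (Φ (suc i) *P_) (foldr-filter n step eq is)
... | false = foldr-filter n step eq is

properProd≡ : ∀ n m → properProd n (cyclotomicList m) ≡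
              prodP (map Φ (map suc (filter (λ i → suc i ∣? n) (upTo m))))
properProd≡ n m = trans (cong (foldr _ oneP) (zip-cyclotomicList m)) (foldr-filter n _ (λ _ _ _ → refl) (upTo m))

-- Duplicate-free lists with the same members are permutations of each other, and a product of
-- polynomials ignores the order. So the filtered range can be traded for an explicit list of proper
-- divisors.
divisors-↭ : ∀ n ds → Unique ds →
  (∀ {d} → d ∈ ds → d ∣ suc n × d < suc n) → (∀ {d} → d ∣ suc n → d < suc n → d ∈ ds) →
  map suc (filter (λ i → suc i ∣? suc n) (upTo n)) ↭ ds
divisors-↭ n ds uds sound complete = ∼bag⇒↭ (unique∧set⇒bag
  (Unique.map⁺ ℕ.suc-injective (Unique.filter⁺ _ (Unique.upTo⁺ n))) uds (mk⇔ to from))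
  where
  to : ∀ {d} → d ∈ map suc (filter (λ i → suc i ∣? suc n) (upTo n)) → d ∈ ds
  to d∈ with i , i∈ , refl ← ∈-map⁻ suc d∈ with i<n , 1+i∣ ← ∈-filter⁻ (λ i → suc i ∣? suc n) {xs = upTo n} i∈ =
    complete 1+i∣ (s≤s (∈-upTo⁻ i<n))
  from : ∀ {d} → d ∈ ds → d ∈ map suc (filter (λ i → suc i ∣? suc n) (upTo n))
  from {zero}  d∈ with divides q eq ← proj₁ (sound d∈) = contradiction (trans eq (ℕ.*-zeroʳ q)) λ ()
  from {suc d} d∈ with d∣ , s≤s d<n ← sound d∈ = ∈-map⁺ suc (∈-filter⁺ _ (∈-upTo⁺ d<n) d∣)

-- Divisors of a product of distinct primes

divisors : List ℕ → List ℕ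
divisors []       = [ 1 ]
divisors (p ∷ ps) = divisors ps ++ map (p *_) (divisors ps)

divisors-sound : ∀ ps {d} → d ∈ divisors ps → d ∣ product ps
divisors-sound []       (here refl) = ∣-refl
divisors-sound (p ∷ ps) d∈ with ∈-++⁻ (divisors ps) d∈
... | inj₁ d∈ₗ = ∣-trans (divisors-sound ps d∈ₗ) (n∣m*n p)
... | inj₂ d∈ᵣ with e , e∈ , refl ← ∈-map⁻ (p *_) d∈ᵣ = *-monoʳ-∣ p (divisors-sound ps e∈)

∣-prime* : ∀ {p d n} → Prime p → d ∣ p * n → d ∣ n ⊎ ∃ λ e → d ≡ p * e × e ∣ n
∣-prime* {p} {d} {n} pp d∣pn with p ∣? d
... | yes (divides e refl) = inj₂ (e , ℕ.*-comm e p , *-cancelˡ-∣ p {{prime⇒nonZero pp}} (subst (_∣ p * n) (ℕ.*-comm e p) d∣pn))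
... | no p∤d = inj₁ (Coprime.coprime-divisor coprime d∣pn)
  where
  coprime : Coprime d p
  coprime (i∣d , i∣p) with prime⇒irreducible pp i∣p
  ... | inj₁ i≡1  = i≡1
  ... | inj₂ refl = contradiction i∣d p∤d

divisors-complete : ∀ ps → All Prime ps → ∀ {d} → d ∣ product ps → d ∈ divisors ps
divisors-complete []       []          d∣1 = here (∣1⇒≡1 d∣1)
divisors-complete (p ∷ ps) (pp ∷ prps) d∣  with ∣-prime* {n = product ps} pp d∣
... | inj₁ d∣n              = ∈-++⁺ˡ (divisors-complete ps prps d∣n)
... | inj₂ (e , refl , e∣n) = ∈-++⁺ʳ (divisors ps) (∈-map⁺ (p *_) (divisors-complete ps prps e∣n))

prime∤1 : ∀ {p} → Prime p → ¬ p ∣ 1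
prime∤1 pp p∣1 = ¬prime[1] (subst Prime (∣1⇒≡1 p∣1) pp)

prime∣prime : ∀ {p q} → Prime p → Prime q → p ∣ q → p ≡ q
prime∣prime pp pq p∣q with prime⇒irreducible pq p∣q
... | inj₁ refl = contradiction pp ¬prime[1]
... | inj₂ p≡q  = p≡q

prime∣product : ∀ {p} → Prime p → ∀ ps → All Prime ps → p ∣ product ps → p ∈ ps
prime∣product pp []       []          p∣ = contradiction p∣ (prime∤1 pp)
prime∣product pp (q ∷ ps) (pq ∷ prps) p∣ with euclidsLemma q (product ps) pp p∣
... | inj₁ p∣q = here (prime∣prime pp pq p∣q)
... | inj₂ p∣r = there (prime∣product pp ps prps p∣r)

divisors-unique : ∀ ps → All Prime ps → Unique ps → Unique (divisors ps)
divisors-unique []       []          []           = [] ∷ []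
divisors-unique (p ∷ ps) (pp ∷ prps) (p∉ ∷ uniq) =
  Unique.++⁺ (divisors-unique ps prps uniq) (Unique.map⁺ (ℕ.*-cancelˡ-≡ _ _ p {{prime⇒nonZero pp}}) (divisors-unique ps prps uniq)) disjoint
  where
  disjoint : ∀ {d} → ¬ (d ∈ divisors ps × d ∈ map (p *_) (divisors ps))
  disjoint (d∈ , d∈p) with e , _ , refl ← ∈-map⁻ (p *_) d∈p =
    All.lookup p∉ (prime∣product pp ps prps (∣-trans (m∣m*n e) (divisors-sound ps d∈))) refl

unique-snoc : ∀ {A : Set} (xs : List A) {y} → Unique (xs ++ [ y ]) → Unique xs × ∀ {x} → x ∈ xs → x ≢ y
unique-snoc []       _        = [] , λ ()
unique-snoc (x ∷ xs) (x∉ ∷ u) with ux , h ← unique-snoc xs u =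
  All.tabulate (λ {z} z∈ → All.lookup x∉ (∈-++⁺ˡ z∈)) ∷ ux ,
  λ { (here refl) → All.lookup x∉ (∈-++⁺ʳ xs (here refl)) ; (there z∈) → h z∈ }

-- `divisors` puts the full product last, so dropping the last entry leaves the proper divisors. For
-- explicit lists of primes the required splitting holds by computation.
properProd≈ : ∀ ps ds {n} → All Prime ps → Unique ps → divisors ps ≡ ds ++ [ product ps ] → product ps ≡ suc n →
  properProd (suc n) (cyclotomicList n) ≈ prodP (map Φ ds)
properProd≈ ps ds {n} prps uniq eq prod with u , ≢prod ← unique-snoc ds (subst Unique eq (divisors-unique ps prps uniq)) =
  ≈-trans (≈-reflexive (properProd≡ (suc n) n)) (prodP-↭ (↭.map⁺ Φ (divisors-↭ n ds u sound complete)))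
  where
  sound : ∀ {d} → d ∈ ds → d ∣ suc n × d < suc n
  sound {d} d∈ = d∣ , ℕ.≤∧≢⇒< (∣⇒≤ d∣) (λ d≡ → ≢prod d∈ (trans d≡ (sym prod)))
    where
    d∣ : d ∣ suc n
    d∣ = subst (d ∣_) prod (divisors-sound ps (subst (d ∈_) (sym eq) (∈-++⁺ˡ d∈)))
  complete : ∀ {d} → d ∣ suc n → d < suc n → d ∈ ds
  complete {d} d∣ d< with ∈-++⁻ ds (subst (d ∈_) eq (divisors-complete ps prps (subst (d ∣_) (sym prod) d∣)))
  ... | inj₁ d∈          = d∈
  ... | inj₂ (here refl) = contradiction prod (ℕ.<⇒≢ d<)

xⁿ-1≈D : ∀ n → xⁿ-1 (suc n) ≈ D (suc n)
xⁿ-1≈D n = ∷-cong refl (≈-trans (≈-reflexive (replicate≡X n)) (≈-sym (+P-identityʳ (X n))))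
  where
  replicate≡X : ∀ n → replicate n ℤ.0ℤ ++ [ ℤ.1ℤ ] ≡ X n
  replicate≡X zero    = refl
  replicate≡X (suc n) = cong (ℤ.0ℤ ∷_) (replicate≡X n)

length-xⁿ-1 : ∀ n → length (xⁿ-1 (suc n)) ≡ suc (suc n)
length-xⁿ-1 n = cong suc (trans (List.length-++ (replicate n ℤ.0ℤ))
  (trans (cong (_+ 1) (List.length-replicate n)) (ℕ.+-comm n 1)))

monic-D : ∀ n → Monic (suc n) (D (suc n))
monic-D n = record
  { lead  = trans (at (+P-identityʳ (X n)) n) (coeff-X-same n)
  ; above = λ { (s≤s n<k) → trans (at (+P-identityʳ (X n)) _) (coeff-X-diff n (ℕ.>⇒≢ n<k)) } }

-- Exact degrees such as (p - 1)(q - 1) would bring in truncated subtraction; the degree of Φ_d is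
-- bounded by d instead.
record MonicUpTo (b : ℕ) (f : Poly) : Set where
  constructor monic≤
  field
    {degree} : ℕ
    degree≤  : degree ≤ b
    monic    : Monic degree f

monicUpTo-* : ∀ {b e f g} → MonicUpTo b f → MonicUpTo e g → MonicUpTo (b + e) (f *P g)
monicUpTo-* (monic≤ d≤ m) (monic≤ e≤ n) = monic≤ (ℕ.+-mono-≤ d≤ e≤) (monic-* m n)

exact : ∀ {f g q d} → f ≈ g *P q → Division f g q d
exact e = record { rem = [] ; rem< = λ _ → refl ; equation = ≈-trans e (≈-sym (+P-identityʳ _)) }

-- If the product of the proper Φ_d has degree at most φ(n), then x^n - 1 divided by the
-- quotient Φ_n returns that product whether or not the first division was exact.
module _ {ps ds n} (prps : All Prime ps) (uniq : Unique ps) (split : divisors ps ≡ ds ++ [ product ps ]) (prod : product ps ≡ suc n) where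

  private
    pp≈ = properProd≈ ps ds prps uniq split prod

  Φ-exact : ∀ {g q b} → prodP (map Φ ds) ≈ g → MonicUpTo b g → b ≤ suc n → D (suc n) ≈ g *P q →
            Φ (suc n) ≈ q × MonicUpTo (suc n) q
  Φ-exact {g} {q} e (monic≤ {d} d≤b m) b≤n Dn≈ = Φ≈q , monic≤ (ℕ.m∸n≤m (suc n) d)
    (monic-resp-≈ Φ≈q (monic-÷P (length-xⁿ-1 n) (monic-resp-≈ (≈-sym (xⁿ-1≈D n)) (monic-D n)) mP (ℕ.≤-trans d≤b b≤n)))
    where
    mP : Monic d (properProd (suc n) (cyclotomicList n))
    mP = monic-resp-≈ (≈-sym (≈-trans pp≈ e)) m
    Φ≈q : Φ (suc n) ≈ q
    Φ≈q = ÷P-unique mP (exact (≈-trans (xⁿ-1≈D n) (≈-trans Dn≈ (*P-cong (≈-sym (≈-trans pp≈ e)) ≈-refl))))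

  Ψ≈properProd : ∀ {g b} → prodP (map Φ ds) ≈ g → MonicUpTo b g → b + b ≤ suc n → Ψ (suc n) ≈ g
  Ψ≈properProd {g} {b} e (monic≤ {d} d≤b m) 2b≤n = ≈-trans (÷P-unique mΦ D′) (≈-trans pp≈ e)
    where
    pp = properProd (suc n) (cyclotomicList n)
    mP : Monic d pp
    mP = monic-resp-≈ (≈-sym (≈-trans pp≈ e)) m
    2d≤n : d + d ≤ suc n
    2d≤n = ℕ.≤-trans (ℕ.+-mono-≤ d≤b d≤b) 2b≤n
    mΦ : Monic (suc n ∸ d) (Φ (suc n))
    mΦ = monic-÷P (length-xⁿ-1 n) (monic-resp-≈ (≈-sym (xⁿ-1≈D n)) (monic-D n)) mP (ℕ.≤-trans (ℕ.m≤m+n d d) 2d≤n)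
    open Division (proj₁ (÷P-correct (xⁿ-1 (suc n)) pp mP))
    -- The same equation with divisor and quotient exchanged. It is again a division, since the
    -- remainder has degree below d ≤ n + 1 - d, the degree of Φ.
    D′ : Division (xⁿ-1 (suc n)) (Φ (suc n)) pp (suc n ∸ d)
    D′ = record { rem = rem ; rem< = degree-mono {f = rem} (ℕ.m+n≤o⇒m≤o∸n d 2d≤n) rem<
                ; equation = ≈-trans equation (+P-congˡ rem (*P-comm pp (Φ (suc n)))) }

-- The polynomials Φ_1, Φ_p and Φ_pq

prime⇒coprime : ∀ {p q} → Prime p → Prime q → p ≢ q → Coprime p q
prime⇒coprime pp pq p≢q (i∣p , i∣q) with prime⇒irreducible pp i∣p
... | inj₁ i≡1  = i≡1
... | inj₂ refl = contradiction (prime∣prime pp pq i∣q) p≢q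

cofactor-< : ∀ {p q} → Prime p → Prime q → p < q → Cofactor p q
cofactor-< pp pq p<q = cofactor (prime⇒coprime pp pq (ℕ.<⇒≢ p<q))

monicUpTo-D₁ : MonicUpTo 1 (D 1)
monicUpTo-D₁ = monic≤ ℕ.≤-refl (monic-D 0)

Φ-1 : Φ 1 ≈ D 1
Φ-1 = ≈-refl

Φ-p : ∀ {p} → Prime p → Φ p ≈ G p × MonicUpTo p (G p)
Φ-p {zero}  pp = contradiction pp ¬prime[0]
Φ-p {suc n} pp = Φ-exact {ps = [ suc n ]} {ds = [ 1 ]} (pp ∷ []) ([] ∷ []) refl (ℕ.*-identityʳ (suc n))
  (≈-trans (*P-identityʳ (Φ 1)) Φ-1) monicUpTo-D₁ (s≤s z≤n) (≈-sym (D₁-*-G (suc n)))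

-- `divisors` computes to entries of the form `p * 1`, which do not reduce for a variable `p`.
Φ-p·1 : ∀ {p} → Prime p → Φ (p * 1) ≈ G p
Φ-p·1 {p} pp = ≈-trans (≈-reflexive (cong Φ (ℕ.*-identityʳ p))) (proj₁ (Φ-p pp))

D-*≈ : ∀ {p q} (C : Cofactor p q) → D (q * p) ≈ (D 1 *P (G p *P G q)) *P cof C
D-*≈ {p} {q} C = begin
  D (q * p)                                ≈⟨ D₁-*-G (q * p) ⟨
  D 1 *P G (q * p)                         ≈⟨ *P-congʳ (D 1) (G-* q p) ⟩
  D 1 *P (G p *P E q p)                    ≈⟨ *P-congʳ (D 1) (*P-congʳ (G p) (cof-*-Gq C)) ⟨
  D 1 *P (G p *P (cof C *P G q))             ≈⟨ solve 4 (λ d g h k → d ⊗ (g ⊗ (h ⊗ k)) , (d ⊗ (g ⊗ k)) ⊗ h) ≈-refl (D 1) (G p) (cof C) (G q) ⟩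
  (D 1 *P (G p *P G q)) *P cof C             ∎
  where open ≈-Reasoning

Φ-pq : ∀ {p q} (pp : Prime p) (pq : Prime q) (p<q : p < q) → 2 ≤ p → let C = cofactor-< pp pq p<q in
       Φ (q * (p * 1)) ≈ cof C × MonicUpTo (q * p) (cof C)
Φ-pq {zero}        {q}          pp pq p<q 2≤p = contradiction pp ¬prime[0]
Φ-pq {p@(suc _)} {q@(suc _)} pp pq p<q 2≤p = ≈-trans (≈-reflexive (cong (λ t → Φ (q * t)) (ℕ.*-identityʳ p))) (proj₁ exact-pq) , proj₂ exact-pq
  where
  bound : 1 + (p + q) ≤ q * p
  bound = begin
    suc p + q      ≤⟨ ℕ.+-monoˡ-≤ q p<q ⟩
    q + q          ≡⟨ cong (q +_) (ℕ.+-identityʳ q) ⟨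
    2 * q          ≤⟨ ℕ.*-monoˡ-≤ q 2≤p ⟩
    p * q          ≡⟨ ℕ.*-comm p q ⟩
    q * p          ∎
    where open ℕ.≤-Reasoning
  exact-pq = Φ-exact {ps = q ∷ p ∷ []} {ds = 1 ∷ p * 1 ∷ q * 1 ∷ []} (pq ∷ pp ∷ [])
    (((λ e → ℕ.<⇒≢ p<q (sym e)) ∷ []) ∷ [] ∷ []) refl (cong (q *_) (ℕ.*-identityʳ p))
    (*P-cong Φ-1 (*P-cong (Φ-p·1 pp) (≈-trans (*P-identityʳ (Φ (q * 1))) (Φ-p·1 pq))))
    (monicUpTo-* monicUpTo-D₁ (monicUpTo-* (proj₂ (Φ-p pp)) (proj₂ (Φ-p pq)))) bound (D-*≈ (cofactor-< pp pq p<q))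

coeff-D* : ∀ n f k → coeff (D n *P f) k ≡ coeff (X n *P f) k ℤ.- coeff f k
coeff-D* n f k = begin
  coeff (D n *P f) k                          ≡⟨ at (solve 2 (λ x f → (x ⊕ ⊝ Κ oneP) ⊗ f , x ⊗ f ⊕ ⊝ f) ≈-refl (X n) f) k ⟩
  coeff (X n *P f +P (-P f)) k                ≡⟨ coeff-+ (X n *P f) _ k ⟩
  coeff (X n *P f) k ℤ.+ coeff (-P f) k       ≡⟨ cong (λ t → coeff (X n *P f) k ℤ.+ t) (coeff-neg f k) ⟩
  coeff (X n *P f) k ℤ.- coeff f k            ∎
  where open ≡-Reasoning

coeff-D*-< : ∀ n f {k} → k < n → coeff (D n *P f) k ≡ ℤ.- coeff f k
coeff-D*-< n f {k} k<n = trans (coeff-D* n f k) (trans (cong (ℤ._- coeff f k) (coeff-X*-< n f k<n)) (ℤ.+-identityˡ _))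

degree-E : ∀ n m → DegreeBelow (suc (n * m)) (E n m)
degree-E zero    m _    = refl
degree-E (suc n) m {k} lt = trans (coeff-+ (E n m) _ k) (cong₂ ℤ._+_
  (degree-E n m (ℕ.≤-trans (s≤s (ℕ.m≤n+m (n * m) m)) lt))
  (coeff-X-diff (n * m) (ℕ.>⇒≢ (ℕ.≤-trans (s≤s (ℕ.m≤n+m (n * m) m)) lt))))

-- The factorisation Ψ_pqr = (x^qr - 1) R and the coefficients of R

module Triple {p q r} (pp : Prime p) (pq : Prime q) (pr : Prime r) (p<q : p < q) (q<r : q < r) (14≤p : 14 ≤ p) where

  private
    p<r = ℕ.<-trans p<q q<r
    2≤p = ℕ.≤-trans (s≤s (s≤s z≤n)) 14≤p
    Cpq = cofactor-< pp pq p<q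
    Cpr = cofactor-< pp pr p<r
    Cqr = cofactor-< pq pr q<r

  R : Poly
  R = cof Cpq *P E p r

  private
    P : Poly
    P = D 1 *P (G p *P (G q *P (cof Cpq *P (G r *P (cof Cpr *P cof Cqr)))))

    instance
      nzp = prime⇒nonZero pp
      nzq = prime⇒nonZero pq
      nzr = prime⇒nonZero pr

    -- The summands bound the degrees of Φ_1, Φ_p, Φ_q, Φ_pq, Φ_r, Φ_pr, Φ_qr, in the order of the
    -- factors of `P`.
    bound : let b = 1 + (p + (q + (q * p + (r + (r * p + r * q))))) in b + b ≤ r * (q * p)
    bound = begin
      b + b
        ≤⟨ ℕ.+-mono-≤ b≤ b≤ ⟩
      7 * n + 7 * n
        ≡⟨ ℕ.*-distribʳ-+ n 7 7 ⟨
      14 * n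
        ≤⟨ ℕ.*-monoˡ-≤ n 14≤p ⟩
      p * (r * q)
        ≡⟨ trans (ℕ.*-comm p (r * q)) (ℕ.*-assoc r q p) ⟩
      r * (q * p) ∎
      where
      open ℕ.≤-Reasoning
      n = r * q
      b = 1 + (p + (q + (q * p + (r + (r * p + r * q)))))
      q≤n : q ≤ n
      q≤n = ℕ.m≤n*m q r
      p≤q = ℕ.<⇒≤ p<q
      b≤ : b ≤ 7 * n
      b≤ = ℕ.+-mono-≤ (ℕ.≤-trans (ℕ.>-nonZero⁻¹ q) q≤n) (ℕ.+-mono-≤ (ℕ.≤-trans p≤q q≤n)
        (ℕ.+-mono-≤ q≤n (ℕ.+-mono-≤ (ℕ.*-mono-≤ (ℕ.<⇒≤ q<r) p≤q) (ℕ.+-mono-≤ (ℕ.m≤m*n r q)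
        (ℕ.+-mono-≤ (ℕ.*-monoʳ-≤ r p≤q) (ℕ.≤-reflexive (sym (ℕ.+-identityʳ n))))))))

    Ψ≈P : Ψ (p * q * r) ≈ P
    -- The product is exposed as a successor, the form in which Φ and Ψ have been analysed.
    Ψ≈P with r * (q * p) in eq | ℕ.m*n≢0 r (q * p) {{nzr}} {{ℕ.m*n≢0 q p}}
    ... | suc n | _ = ≈-trans (≈-reflexive (cong Ψ pqr≡)) (Ψ≈properProd {ps = r ∷ q ∷ p ∷ []}
      {ds = 1 ∷ p * 1 ∷ q * 1 ∷ q * (p * 1) ∷ r * 1 ∷ r * (p * 1) ∷ r * (q * 1) ∷ []} (pr ∷ pq ∷ pp ∷ [])
      (((λ e → ℕ.<⇒≢ q<r (sym e)) ∷ (λ e → ℕ.<⇒≢ p<r (sym e)) ∷ []) ∷ ((λ e → ℕ.<⇒≢ p<q (sym e)) ∷ []) ∷ [] ∷ [])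
      refl (trans (cong (λ t → r * (q * t)) (ℕ.*-identityʳ p)) eq)
      (*P-cong Φ-1 (*P-cong (Φ-p·1 pp) (*P-cong (Φ-p·1 pq) (*P-cong (proj₁ Φpq) (*P-cong (Φ-p·1 pr)
        (*P-cong (proj₁ Φpr) (≈-trans (*P-identityʳ (Φ (r * (q * 1)))) (proj₁ Φqr))))))))
      (monicUpTo-* monicUpTo-D₁ (monicUpTo-* (proj₂ (Φ-p pp)) (monicUpTo-* (proj₂ (Φ-p pq)) (monicUpTo-* (proj₂ Φpq)
        (monicUpTo-* (proj₂ (Φ-p pr)) (monicUpTo-* (proj₂ Φpr) (proj₂ Φqr)))))))
      (ℕ.≤-trans bound (ℕ.≤-reflexive eq)))
      where
      Φpq = Φ-pq pp pq p<q 2≤p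
      Φpr = Φ-pq pp pr p<r 2≤p
      Φqr = Φ-pq pq pr q<r (ℕ.≤-trans 2≤p (ℕ.<⇒≤ p<q))
      pqr≡ : p * q * r ≡ suc n
      pqr≡ = trans (ℕ.*-comm (p * q) r) (trans (cong (r *_) (ℕ.*-comm p q)) eq)

  -- Group the seven factors: Φ_qr G(q) = E(q,r) and G(r) E(q,r) = G(qr), which together with x - 1
  -- make x^qr - 1. What remains is Φ_pq (Φ_pr G(p)) = Φ_pq E(p,r) = R.
  Ψ≈D*R : Ψ (p * q * r) ≈ D (q * r) *P R
  Ψ≈D*R = begin
    Ψ (p * q * r)
      ≈⟨ Ψ≈P ⟩
    P
      ≈⟨ solve 7 (λ d gp gq h gr h′ h″ → d ⊗ (gp ⊗ (gq ⊗ (h ⊗ (gr ⊗ (h′ ⊗ h″))))) , (d ⊗ (gr ⊗ (h″ ⊗ gq))) ⊗ (h ⊗ (h′ ⊗ gp)))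
           ≈-refl (D 1) (G p) (G q) (cof Cpq) (G r) (cof Cpr) (cof Cqr) ⟩
    (D 1 *P (G r *P (cof Cqr *P G q))) *P (cof Cpq *P (cof Cpr *P G p))
      ≈⟨ *P-cong (*P-congʳ (D 1) (*P-congʳ (G r) (cof-*-Gp Cqr))) (*P-congʳ (cof Cpq) (cof-*-Gp Cpr)) ⟩
    (D 1 *P (G r *P E q r)) *P R
      ≈⟨ *P-cong (*P-congʳ (D 1) (≈-sym (G-* q r))) ≈-refl ⟩
    (D 1 *P G (q * r)) *P R
      ≈⟨ *P-cong (D₁-*-G (q * r)) ≈-refl ⟩
    D (q * r) *P R ∎
    where open ≈-Reasoning

  -- The generating function of the sums sr + bq + ap with s, b < p and a < L. The factor `E L p`
  -- stands for the power series 1/(1 - x^p), with which it agrees below degree Lp.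
  M : ℕ → Poly
  M L = E p r *P (E p q *P E L p)

  R*D≈D*M : ∀ L → R *P D (L * p) ≈ D 1 *P M L
  R*D≈D*M L = begin
    R *P D (L * p)
      ≈⟨ *P-congʳ R (≈-trans (≈-sym (D-*-E L p)) (*P-cong (≈-sym (D₁-*-G p)) (≈-refl {E L p}))) ⟩
    R *P ((D 1 *P G p) *P E L p)
      ≈⟨ solve 5 (λ h e d g l → (h ⊗ e) ⊗ ((d ⊗ g) ⊗ l) , d ⊗ (e ⊗ ((h ⊗ g) ⊗ l))) ≈-refl (cof Cpq) (E p r) (D 1) (G p) (E L p) ⟩
    D 1 *P (E p r *P ((cof Cpq *P G p) *P E L p))
      ≈⟨ *P-congʳ (D 1) (*P-congʳ (E p r) (*P-cong (cof-*-Gp Cpq) (≈-refl {E L p}))) ⟩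
    D 1 *P M L ∎
    where open ≈-Reasoning

  -- Below degree Lp the product R (x^(Lp) - 1) is -R, so R agrees there with (1 - x) M. The
  -- prepended zero encodes M(k - 1), with value 0 at k = 0.
  coeff-R : ∀ L {k} → k < L * p → coeff R k ≡ coeff (M L) k ℤ.- coeff (ℤ.0ℤ ∷ M L) k
  coeff-R L {k} k<Lp = ℤ.neg-injective (begin
    ℤ.- coeff R k                                             ≡⟨ coeff-D*-< (L * p) R k<Lp ⟨
    coeff (D (L * p) *P R) k                                  ≡⟨ at (≈-trans (*P-comm (D (L * p)) R) (R*D≈D*M L)) k ⟩
    coeff (D 1 *P M L) k                                      ≡⟨ coeff-D* 1 (M L) k ⟩
    coeff (X 1 *P M L) k ℤ.- coeff (M L) k                    ≡⟨ cong (ℤ._- coeff (M L) k) (at (≈-trans (X-*P 0 (M L)) (∷-cong refl (*P-identityˡ (M L)))) k) ⟩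
    coeff (ℤ.0ℤ ∷ M L) k ℤ.- coeff (M L) k                    ≡⟨ flip-sub (coeff (ℤ.0ℤ ∷ M L) k) (coeff (M L) k) ⟩
    ℤ.- (coeff (M L) k ℤ.- coeff (ℤ.0ℤ ∷ M L) k)              ∎)
    where
    open ≡-Reasoning
    flip-sub : ∀ x y → x ℤ.- y ≡ ℤ.- (y ℤ.- x)
    flip-sub = solve-∀

  c-low : ∀ {k} → k < q * r → c (p * q * r) k ≡ ℤ.- coeff R k
  c-low {k} k<qr = trans (at Ψ≈D*R k) (coeff-D*-< (q * r) R k<qr)

  -- The copies -R and x^qr R do not overlap: the degree of R is at most qp + pr < 2pr ≤ qr.
  c-high : 2 * p ≤ q → ∀ k → c (p * q * r) (q * r + k) ≡ coeff R k
  c-high 2p≤q k = begin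
    c (p * q * r) (q * r + k)
      ≡⟨ at Ψ≈D*R (q * r + k) ⟩
    coeff (D (q * r) *P R) (q * r + k)
      ≡⟨ coeff-D* (q * r) R (q * r + k) ⟩
    coeff (X (q * r) *P R) (q * r + k) ℤ.- coeff R (q * r + k)
      ≡⟨ cong₂ ℤ._-_ (coeff-X*-≥ (q * r) R k) (R< (ℕ.≤-trans deg (ℕ.m≤m+n (q * r) k))) ⟩
    coeff R k ℤ.- ℤ.0ℤ
      ≡⟨ ℤ.+-identityʳ _ ⟩
    coeff R k ∎
    where
    open ≡-Reasoning
    open MonicUpTo (proj₂ (Φ-pq pp pq p<q 2≤p))
    R< : DegreeBelow (suc (degree + p * r)) R
    R< = degree-* (cof Cpq) (E p r) (Monic.above monic) (degree-E p r)
    deg : suc (degree + p * r) ≤ q * r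
    deg = ≤R.begin
      suc (degree + p * r)      ≤R.≤⟨ s≤s (ℕ.+-monoˡ-≤ (p * r) degree≤) ⟩
      suc (q * p) + p * r       ≤R.≤⟨ ℕ.+-monoˡ-≤ (p * r) (ℕ.*-monoˡ-< p q<r) ⟩
      r * p + p * r             ≤R.≡⟨ trans (cong (_+ p * r) (ℕ.*-comm r p)) (sym (trans (ℕ.*-distribʳ-+ r p (1 * p)) (cong (λ t → p * r + t * r) (ℕ.*-identityˡ p)))) ⟩
      2 * p * r                 ≤R.≤⟨ ℕ.*-monoˡ-≤ r 2p≤q ⟩
      q * r                     ≤R.∎
      where module ≤R = ℕ.≤-Reasoning

-- Counting representations s r + b q + a p

E-suc-* : ∀ n m f k → coeff (E (suc n) m *P f) k ≡ coeff (E n m *P f) k ℤ.+ coeff (X (n * m) *P f) k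
E-suc-* n m f k = trans (at (*P-distribʳ f (E n m) (X (n * m))) k) (coeff-+ (E n m *P f) _ k)

-- In every count below, each s admits at most one representation, and the s that admit one form an
-- initial segment.
coeff-E*-count : ∀ n m f k {t} → t ≤ n → (∀ {s} → s < t → coeff (X (s * m) *P f) k ≡ ℤ.1ℤ) →
  (∀ {s} → t ≤ s → s < n → coeff (X (s * m) *P f) k ≡ ℤ.0ℤ) → coeff (E n m *P f) k ≡ ℤ.+ t
coeff-E*-count zero    m f k z≤n ones zeros = refl
coeff-E*-count (suc n) m f k {t} t≤1+n ones zeros with ℕ.m≤n⇒m<n∨m≡n t≤1+n
... | inj₁ (s≤s t≤n) = trans (E-suc-* n m f k) (trans (cong₂ ℤ._+_
  (coeff-E*-count n m f k t≤n ones (λ t≤s s<n → zeros t≤s (ℕ.m<n⇒m<1+n s<n)))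
  (zeros t≤n ℕ.≤-refl)) (ℤ.+-identityʳ _))
... | inj₂ refl = trans (E-suc-* n m f k) (trans (cong₂ ℤ._+_
  (coeff-E*-count n m f k ℕ.≤-refl (λ s<n → ones (ℕ.m<n⇒m<1+n s<n)) (λ n≤s s<n → contradiction s<n (ℕ.≤⇒≯ n≤s)))
  (ones ℕ.≤-refl)) (cong ℤ.+_ (ℕ.+-comm n 1)))

coeff-E*-vanish : ∀ n m f k → (∀ {s} → s < n → coeff (X (s * m) *P f) k ≡ ℤ.0ℤ) → coeff (E n m *P f) k ≡ ℤ.0ℤ
coeff-E*-vanish n m f k zeros = coeff-E*-count n m f k z≤n (λ ()) (λ _ → zeros)

coeff-E*-single : ∀ n m f k {b} → b < n → coeff (X (b * m) *P f) k ≡ ℤ.1ℤ →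
  (∀ {s} → s < n → s ≢ b → coeff (X (s * m) *P f) k ≡ ℤ.0ℤ) → coeff (E n m *P f) k ≡ ℤ.1ℤ
coeff-E*-single (suc n) m f k {b} b<1+n one zeros with ℕ.m≤n⇒m<n∨m≡n b<1+n
... | inj₁ (s≤s b<n) = trans (E-suc-* n m f k) (trans (cong₂ ℤ._+_
  (coeff-E*-single n m f k b<n one (λ s<n → zeros (ℕ.m<n⇒m<1+n s<n)))
  (zeros ℕ.≤-refl (ℕ.>⇒≢ b<n))) (ℤ.+-identityʳ _))
... | inj₂ refl = trans (E-suc-* n m f k) (cong₂ ℤ._+_
  (coeff-E*-vanish n m f k (λ s<n → zeros (ℕ.m<n⇒m<1+n s<n) (ℕ.<⇒≢ s<n))) one)

coeff-E-vanish : ∀ L p k → (∀ {a} → a < L → a * p ≢ k) → coeff (E L p) k ≡ ℤ.0ℤ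
coeff-E-vanish L p k ≢k = trans (sym (at (*P-identityʳ (E L p)) k)) (coeff-E*-vanish L p oneP k
  λ {a} a<L → trans (at (*P-identityʳ (X (a * p))) k) (coeff-X-diff (a * p) (λ e → ≢k a<L (sym e))))

coeff-E-one : ∀ L p .{{_ : NonZero p}} {a} → a < L → coeff (E L p) (a * p) ≡ ℤ.1ℤ
coeff-E-one L p {a} a<L = trans (sym (at (*P-identityʳ (E L p)) (a * p))) (coeff-E*-single L p oneP (a * p) a<L
  (trans (at (*P-identityʳ (X (a * p))) (a * p)) (coeff-X-same (a * p)))
  λ {s} _ s≢a → trans (at (*P-identityʳ (X (s * p))) (a * p)) (coeff-X-diff (s * p) (λ e → s≢a (sym (ℕ.*-cancelʳ-≡ a s p e)))))

-- Modulo p the equation reads nq ≡ mq, and q is invertible.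
*+*-∣∸ : ∀ {p q} → Coprime p q → ∀ {m n} x y → n * q + x * p ≡ m * q + y * p → m ≤ n → p ∣ n ∸ m
*+*-∣∸ {p} {q} cop {m} {n} x y eq m≤n = Coprime.coprime-divisor cop
  (∣m+n∣m⇒∣n (subst (p ∣_) yp≡ (n∣m*n y)) (n∣m*n x))
  where
  yp≡ : y * p ≡ x * p + q * (n ∸ m)
  yp≡ = ℕ.+-cancelˡ-≡ (m * q) _ _ (begin
    m * q + y * p                         ≡⟨ eq ⟨
    n * q + x * p                         ≡⟨ cong (λ t → t * q + x * p) (ℕ.m+[n∸m]≡n m≤n) ⟨
    (m + (n ∸ m)) * q + x * p             ≡⟨ shuffle m (n ∸ m) q (x * p) ⟩
    m * q + (x * p + q * (n ∸ m))         ∎)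
    where
    open ≡-Reasoning
    shuffle : ∀ m d q z → (m + d) * q + z ≡ m * q + (z + q * d)
    shuffle = ℕ-solve-∀

∣∸⇒+≤ : ∀ {p m n} → p ∣ n ∸ m → m < n → m + p ≤ n
∣∸⇒+≤ {p} {m} {n} p∣ m<n = subst (m + p ≤_) (ℕ.m+[n∸m]≡n (ℕ.<⇒≤ m<n))
  (ℕ.+-monoʳ-≤ m (∣⇒≤ {{ℕ.>-nonZero (ℕ.m<n⇒0<n∸m m<n)}} p∣))

*+*-injective : ∀ {p q} → Coprime p q → ∀ {m n} x y → m < p → n < p → n * q + x * p ≡ m * q + y * p → n ≡ m
*+*-injective {p} cop {m} {n} x y m<p n<p eq with ℕ.<-cmp n m
... | tri≈ _ n≡m _ = n≡m
... | tri< n<m _ _ = contradiction (ℕ.≤-trans m<p (ℕ.≤-trans (ℕ.m≤n+m p n) (∣∸⇒+≤ (*+*-∣∸ cop y x (sym eq) (ℕ.<⇒≤ n<m)) n<m))) (ℕ.<-irrefl refl)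
... | tri> _ _ m<n = contradiction (ℕ.≤-trans n<p (ℕ.≤-trans (ℕ.m≤n+m p m) (∣∸⇒+≤ (*+*-∣∸ cop x y eq (ℕ.<⇒≤ m<n)) m<n))) (ℕ.<-irrefl refl)

coeff-EE-vanish : ∀ p q L j → (∀ {b} a → b < p → b * q + a * p ≢ j) → coeff (E p q *P E L p) j ≡ ℤ.0ℤ
coeff-EE-vanish p q L j norep = coeff-E*-vanish p q (E L p) j λ {b} b<p →
  coeff-X*-vanish (b * q) (E L p) j λ i bq+i≡j → coeff-E-vanish L p i λ { {a} _ refl → norep a b<p bq+i≡j }

coeff-EE-one : ∀ {p q} .{{_ : NonZero p}} → Coprime p q → ∀ L {b a} → b < p → a < L →
               coeff (E p q *P E L p) (b * q + a * p) ≡ ℤ.1ℤ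
coeff-EE-one {p} {q} cop L {b} {a} b<p a<L = coeff-E*-single p q (E L p) (b * q + a * p) b<p
  (trans (coeff-X*-≥ (b * q) (E L p) (a * p)) (coeff-E-one L p a<L))
  λ {s} s<p s≢b → coeff-X*-vanish (s * q) (E L p) _ λ i sq+i≡ → coeff-E-vanish L p i
    λ { {a′} _ refl → s≢b (*+*-injective cop a′ a b<p s<p sq+i≡) }

-- Counting representations when r ≡ q mod p

module Congruent {p q w v e : ℕ} (pp : Prime p) (pq : Prime q) (p<q : p < q)
  (wq≡1+vp : w * q ≡ 1 + v * p) (w<p : w < p) .{{_ : NonZero e}} where

  r : ℕ
  r = q + e * p

  M : Poly
  M = E p r *P (E p q *P E q p)

  private
    instance
      nzp = prime⇒nonZero pp
      nzq = prime⇒nonZero pq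

    cop : Coprime p q
    cop = prime⇒coprime pp pq (ℕ.<⇒≢ p<q)

    v<q : v < q
    v<q = ℕ.*-cancelʳ-< p v q (begin-strict
      v * p        <⟨ ℕ.≤-refl ⟩
      1 + v * p    ≡⟨ wq≡1+vp ⟨
      w * q        ≤⟨ ℕ.*-monoˡ-≤ q (ℕ.<⇒≤ w<p) ⟩
      p * q        ≡⟨ ℕ.*-comm p q ⟩
      q * p        ∎)
      where open ℕ.≤-Reasoning

    term-one : ∀ {s b a k} → b < p → a < q → k ≡ s * r + (b * q + a * p) → coeff (X (s * r) *P (E p q *P E q p)) k ≡ ℤ.1ℤ
    term-one {s} {b} {a} b<p a<q refl = trans (coeff-X*-≥ (s * r) _ _) (coeff-EE-one cop q b<p a<q)

    -- As r = q + ep, the sum sr + bq + ap equals (s + b)q + (se + a)p, so its residue modulo p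
    -- constrains s + b alone.
    term-zero : ∀ {s k} → (∀ {b a} → b < p → (s + b) * q + (s * e + a) * p ≢ k) → coeff (X (s * r) *P (E p q *P E q p)) k ≡ ℤ.0ℤ
    term-zero {s} {k} norep = coeff-X*-vanish (s * r) _ k λ i sr+i≡k → coeff-EE-vanish p q q i
      λ { {b} a b<p refl → norep b<p (trans (shuffle s b a q e p) sr+i≡k) }
      where
      shuffle : ∀ s b a q e p → (s + b) * q + (s * e + a) * p ≡ s * (q + e * p) + (b * q + a * p)
      shuffle = ℕ-solve-∀

  module _ {m : ℕ} (mep<q : m * e * p < q) where

    private
      split : ∀ {s t} → s ≤ t → t * r ≡ s * r + ((t ∸ s) * q + (t ∸ s) * e * p)
      split {s} {t} s≤t = trans (cong (_* r) (sym (ℕ.m+[n∸m]≡n s≤t))) (shuffle s (t ∸ s) q e p)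
        where
        shuffle : ∀ s d q e p → (s + d) * (q + e * p) ≡ s * (q + e * p) + (d * q + d * e * p)
        shuffle = ℕ-solve-∀

    module _ (w+m<p : w + m < p) where

      private
        instance
          nzw : NonZero w
          nzw = ℕ.≢-nonZero λ { refl → contradiction wq≡1+vp λ () }

        me≤v : m * e ≤ v
        me≤v = ℕ.*-cancelʳ-≤ (m * e) v p (ℕ.s≤s⁻¹ (begin
          1 + m * e * p     ≤⟨ mep<q ⟩
          q                 ≤⟨ ℕ.m≤n*m q w ⟩
          w * q             ≡⟨ wq≡1+vp ⟩
          1 + v * p         ∎))
          where open ℕ.≤-Reasoning

        m<p = ℕ.≤-trans (s≤s (ℕ.m≤n+m m w)) w+m<p

      M-before : coeff M (m * q + v * p) ≡ ℤ.+ suc m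
      M-before = coeff-E*-count p r _ _ m<p ones zeros
        where
        ones : ∀ {s} → s < suc m → coeff (X (s * r) *P (E p q *P E q p)) (m * q + v * p) ≡ ℤ.1ℤ
        ones {s} (s≤s s≤m) = term-one {s} (ℕ.≤-trans (s≤s (ℕ.m∸n≤m m s)) m<p) (ℕ.≤-trans (s≤s (ℕ.m∸n≤m v (s * e))) v<q)
          (trans (cong₂ (λ x y → x * q + y * p) (sym (ℕ.m+[n∸m]≡n s≤m)) (sym (ℕ.m+[n∸m]≡n (ℕ.≤-trans (ℕ.*-monoˡ-≤ e s≤m) me≤v))))
                 (shuffle s (m ∸ s) (v ∸ s * e) q e p))
          where
          shuffle : ∀ s b a q e p → (s + b) * q + (s * e + a) * p ≡ s * (q + e * p) + (b * q + a * p)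
          shuffle = ℕ-solve-∀
        zeros : ∀ {s} → suc m ≤ s → s < p → coeff (X (s * r) *P (E p q *P E q p)) (m * q + v * p) ≡ ℤ.0ℤ
        -- Now s + b > m and s + b ≡ m mod p, so s + b ≥ m + p. But (m + p)q exceeds mq + vp because
        -- v < q.
        zeros {s} m<s s<p = term-zero {s} λ {b} {a} b<p eq →
          let m<s+b = ℕ.≤-trans m<s (ℕ.m≤m+n s b)
              m+p≤s+b = ∣∸⇒+≤ (*+*-∣∸ cop (s * e + a) v eq (ℕ.<⇒≤ m<s+b)) m<s+b
          in contradiction (ℕ.≤-<-trans (too-big m+p≤s+b eq) (ℕ.+-monoʳ-< (m * q) (ℕ.*-monoˡ-< p v<q))) (ℕ.<-irrefl (shuffle m p q))
          where
          shuffle : ∀ m p q → (m + p) * q ≡ m * q + q * p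
          shuffle = ℕ-solve-∀
          too-big : ∀ {n x} → m + p ≤ n → n * q + x ≡ m * q + v * p → (m + p) * q ≤ m * q + v * p
          too-big {n} {x} m+p≤n eq = ℕ.≤-trans (ℕ.*-monoˡ-≤ q m+p≤n) (ℕ.≤-trans (ℕ.m≤m+n (n * q) x) (ℕ.≤-reflexive eq))

      M-at : coeff M ((w + m) * q) ≡ ℤ.1ℤ
      M-at = coeff-E*-count p r _ _ (ℕ.≤-trans (s≤s z≤n) w<p) ones zeros
        where
        ones : ∀ {s} → s < 1 → coeff (X (s * r) *P (E p q *P E q p)) ((w + m) * q) ≡ ℤ.1ℤ
        ones {zero} _ = term-one {0} w+m<p (ℕ.≤-trans (s≤s z≤n) p<q) (sym (ℕ.+-identityʳ _))
        ones {suc _} (s≤s ())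
        zeros : ∀ {s} → 1 ≤ s → s < p → coeff (X (s * r) *P (E p q *P E q p)) ((w + m) * q) ≡ ℤ.0ℤ
        -- Size gives s + b ≤ w + m < p, and the congruence then s + b = w + m. Nothing is left for
        -- (se + a)p, although s and e are positive.
        zeros {s@(suc _)} _ s<p = term-zero {s} λ {b} {a} b<p eq →
          let s+b≤β = ℕ.*-cancelʳ-≤ (s + b) (w + m) q (ℕ.≤-trans (ℕ.m≤m+n ((s + b) * q) _) (ℕ.≤-reflexive eq))
              s+b≡β = *+*-injective cop (s * e + a) 0 w+m<p (ℕ.≤-<-trans s+b≤β w+m<p) (trans eq (sym (ℕ.+-identityʳ ((w + m) * q))))
              se+a≡0 = ℕ.m+n≡0⇒m≡0 (s * e) {a} (ℕ.m*n≡0⇒m≡0 (s * e + a) p (ℕ.+-cancelˡ-≡ ((s + b) * q) _ 0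
                (trans eq (trans (cong (_* q) (sym s+b≡β)) (sym (ℕ.+-identityʳ _))))))
          in contradiction se+a≡0 (ℕ.≢-nonZero⁻¹ (s * e) {{ℕ.m*n≢0 s e}})

    module _ {t} (m≡1+t : m ≡ suc t) (t<w : t < w) where

      private
        tep<q : t * e * p < q
        tep<q = ℕ.≤-<-trans (ℕ.*-monoˡ-≤ p (ℕ.*-monoˡ-≤ e (ℕ.≤-trans (ℕ.n≤1+n t) (ℕ.≤-reflexive (sym m≡1+t))))) mep<q

        te<q : t * e < q
        te<q = ℕ.≤-<-trans (ℕ.m≤m*n (t * e) p) tep<q

        t<p = ℕ.<-trans t<w w<p

      M-at′ : coeff M (t * r) ≡ ℤ.+ suc t
      M-at′ = coeff-E*-count p r _ _ t<p ones zeros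
        where
        ones : ∀ {s} → s < suc t → coeff (X (s * r) *P (E p q *P E q p)) (t * r) ≡ ℤ.1ℤ
        ones {s} (s≤s s≤t) = term-one {s} (ℕ.≤-<-trans (ℕ.m∸n≤m t s) t<p) (ℕ.≤-<-trans (ℕ.*-monoˡ-≤ e (ℕ.m∸n≤m t s)) te<q) (split s≤t)
        zeros : ∀ {s} → suc t ≤ s → s < p → coeff (X (s * r) *P (E p q *P E q p)) (t * r) ≡ ℤ.0ℤ
        zeros {s} t<s _ = coeff-X*-< (s * r) _ (ℕ.*-monoˡ-< r {{ℕ.>-nonZero (ℕ.≤-trans (ℕ.>-nonZero⁻¹ q) (ℕ.m≤m+n q (e * p)))}} t<s)

      -- Adding wq = 1 + vp to a representation of tr - 1 gives (s + b + w)q + (se + a)p = tq + (te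
      -- + v)p. Hence s + b + w ≡ t mod p, and since w > t even s + b + w ≥ t + p. Size allows only
      -- s + b ≤ t, which contradicts w < p.
      M-before′ : ∀ {j} → suc j ≡ t * r → coeff M j ≡ ℤ.0ℤ
      M-before′ {j} 1+j≡tr = coeff-E*-vanish p r _ j λ {s} s<p → term-zero {s} λ {b} {a} b<p eq →
        let eq′ = trans (shuffle s b a) (trans (cong (λ z → suc (z + v * p)) eq) (trans (cong (_+ v * p) 1+j≡tr) (shuffle′ t q e p v)))
            t<N = ℕ.≤-trans t<w (ℕ.m≤n+m w (s + b))
            t+p≤N = ∣∸⇒+≤ (*+*-∣∸ cop (s * e + a) (t * e + v) eq′ (ℕ.<⇒≤ t<N)) t<N
            s+b≤t = ℕ.s≤s⁻¹ (ℕ.*-cancelʳ-< q (s + b) (suc t) (small s b a eq))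
        in contradiction (ℕ.≤-trans t+p≤N (ℕ.+-monoˡ-≤ w s+b≤t)) (ℕ.<⇒≱ (ℕ.+-monoʳ-< t w<p))
        where
        shuffle : ∀ s b a → (s + b + w) * q + (s * e + a) * p ≡ suc ((s + b) * q + (s * e + a) * p + v * p)
        shuffle s b a = trans (expand (s + b) w q ((s * e + a) * p)) (trans (cong (λ z → (s + b) * q + (s * e + a) * p + z) wq≡1+vp) (ℕ.+-suc _ (v * p)))
          where
          expand : ∀ n w q z → (n + w) * q + z ≡ n * q + z + w * q
          expand = ℕ-solve-∀
        shuffle′ : ∀ t q e p v → t * (q + e * p) + v * p ≡ t * q + (t * e + v) * p
        shuffle′ = ℕ-solve-∀
        small : ∀ s b a → (s + b) * q + (s * e + a) * p ≡ j → (s + b) * q < suc t * q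
        small s b a eq = begin-strict
          (s + b) * q                         ≤⟨ ℕ.m≤m+n _ ((s * e + a) * p) ⟩
          (s + b) * q + (s * e + a) * p       ≡⟨ eq ⟩
          j                                   <⟨ ℕ.n<1+n j ⟩
          suc j                               ≡⟨ trans 1+j≡tr (expand t q e p) ⟩
          t * q + t * e * p                   <⟨ ℕ.+-monoʳ-< (t * q) tep<q ⟩
          t * q + q                           ≡⟨ ℕ.+-comm (t * q) q ⟩
          suc t * q                           ∎
          where
          open ℕ.≤-Reasoning
          expand : ∀ t q e p → t * (q + e * p) ≡ t * q + t * e * p
          expand = ℕ-solve-∀

-- Primes that are congruent and close to each other

prime-divisor : ∀ {n} → 2 ≤ n → ∃ λ d → Prime d × d ∣ n
prime-divisor {suc n} 2≤n with factorise (suc n)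
... | record { factors = [] ; isFactorisation = refl } = contradiction 2≤n λ { (s≤s ()) }
... | record { factors = d ∷ ds ; isFactorisation = eq ; factorsPrime = pd ∷ _ } = d , pd , subst (d ∣_) (sym eq) (m∣m*n _)

-- Only a short list covering the wanted numbers is required, so `t` is tried as a factor without a
-- primality test and surplus entries are harmless. A prime factor at least halves the number, so
-- `n` bounds how many factors can still be split off.
smooth : ℕ → ℕ → List ℕ
smooth zero    n       = [ 1 ]
smooth (suc t) zero    = [ 1 ]
smooth (suc t) (suc n) = smooth t (suc n) ++ map (t *_) (smooth (suc t) n)

-- The bound is the number of vectors of t exponents between 0 and n.
length-smooth : ∀ t n → length (smooth t n) ≤ suc n ^ t
length-smooth zero    n       = ℕ.≤-refl
length-smooth (suc t) zero    = ℕ.≤-reflexive (sym (ℕ.^-zeroˡ (suc t)))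
length-smooth (suc t) (suc n) = begin
  length (smooth t (suc n) ++ map (t *_) (smooth (suc t) n))
    ≡⟨ trans (List.length-++ (smooth t (suc n))) (cong (length (smooth t (suc n)) +_) (List.length-map (t *_) (smooth (suc t) n))) ⟩
  length (smooth t (suc n)) + length (smooth (suc t) n)
    ≤⟨ ℕ.+-mono-≤ (length-smooth t (suc n)) (length-smooth (suc t) n) ⟩
  suc (suc n) ^ t + suc n * suc n ^ t
    ≤⟨ ℕ.+-monoʳ-≤ (suc (suc n) ^ t) (ℕ.*-monoʳ-≤ (suc n) (ℕ.^-monoˡ-≤ t (ℕ.n≤1+n (suc n)))) ⟩
  suc (suc n) ^ suc t ∎
  where open ℕ.≤-Reasoning

smooth-complete : ∀ t n {x} → 1 ≤ x → x ≤ 2 ^ n → (∀ {d} → Prime d → d ∣ x → d < t) → x ∈ smooth t n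
smooth-complete zero    n {suc zero}    _ _ _ = here refl
smooth-complete zero    n {suc (suc x)} _ _ h with d , pd , d∣x ← prime-divisor {suc (suc x)} (s≤s (s≤s z≤n)) with () ← h pd d∣x
smooth-complete (suc t) zero 1≤x x≤1 _ = here (ℕ.≤-antisym x≤1 1≤x)
smooth-complete (suc t) (suc n) {x} 1≤x x≤ h with prime? t ×-dec (t ∣? x)
... | no ¬t = ∈-++⁺ˡ (smooth-complete t (suc n) 1≤x x≤ λ {d} pd d∣x →
  ℕ.≤∧≢⇒< (ℕ.s≤s⁻¹ (h pd d∣x)) λ { refl → ¬t (pd , d∣x) })
... | yes (pt , divides y refl) = ∈-++⁺ʳ (smooth t (suc n)) (subst (_∈ map (t *_) (smooth (suc t) n)) (ℕ.*-comm t y)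
  (∈-map⁺ (t *_) (smooth-complete (suc t) n 1≤y y≤ λ pd d∣y → h pd (∣-trans d∣y (m∣m*n t)))))
  where
  1≤y : 1 ≤ y
  1≤y = ℕ.n≢0⇒n>0 λ { refl → contradiction 1≤x λ () }
  y≤ : y ≤ 2 ^ n
  y≤ = ℕ.*-cancelʳ-≤ y (2 ^ n) 2 (begin
    y * 2       ≤⟨ ℕ.*-monoʳ-≤ y (ℕ.nonTrivial⇒n>1 t {{prime⇒nonTrivial pt}}) ⟩
    y * t       ≤⟨ x≤ ⟩
    2 * 2 ^ n   ≡⟨ ℕ.*-comm 2 (2 ^ n) ⟩
    2 ^ n * 2   ∎)
    where open ℕ.≤-Reasoning

length-covering : ∀ N (xs : List ℕ) → (∀ {x} → 1 ≤ x → x ≤ N → x ∈ xs) → N ≤ length xs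
length-covering N xs cover = Fin.injective⇒≤ {f = f} inj
  where
  member : ∀ (i : Fin N) → suc (toℕ i) ∈ xs
  member i = cover (s≤s z≤n) (Fin.toℕ<n i)
  f : Fin N → Fin (length xs)
  f i = index (member i)
  inj : ∀ {i j} → f i ≡ f j → i ≡ j
  inj {i} {j} e = Fin.toℕ-injective (ℕ.suc-injective
    (trans (Any.lookup-index (member i)) (trans (cong (lookup xs) e) (sym (Any.lookup-index (member j))))))

2n≤2^n : ∀ n → 1 ≤ n → 2 * n ≤ 2 ^ n
2n≤2^n (suc zero)    _ = ℕ.≤-refl
2n≤2^n (suc (suc n)) _ = begin
  2 * suc (suc n)              ≤⟨ ℕ.*-monoʳ-≤ 2 (ℕ.≤-trans (s≤s (s≤s (ℕ.m≤n+m n n))) (ℕ.≤-reflexive (double n))) ⟩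
  2 * (2 * suc n)              ≤⟨ ℕ.*-monoʳ-≤ 2 (2n≤2^n (suc n) (s≤s z≤n)) ⟩
  2 ^ suc (suc n)              ∎
  where
  open ℕ.≤-Reasoning
  double : ∀ n → suc (suc (n + n)) ≡ 2 * suc n
  double = ℕ-solve-∀

exponential>polynomial : ∀ t → ∃ λ n → 2 * suc n ^ t < 2 ^ n
-- With n + 1 = 2^j both sides are powers of two, and 1 + jt < 2^j - 1 remains. The choice j = 2(t +
-- 2) works because 2^j ≥ (2(t + 2))^2.
exponential>polynomial t = 2 ^ j ∸ 1 , (begin-strict
  2 * suc (2 ^ j ∸ 1) ^ t       ≡⟨ cong (λ x → 2 * x ^ t) (ℕ.m+[n∸m]≡n (ℕ.m^n>0 2 j)) ⟩
  2 * (2 ^ j) ^ t               ≡⟨ cong (2 *_) (ℕ.^-*-assoc 2 j t) ⟩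
  2 ^ suc (j * t)               <⟨ ℕ.^-monoʳ-< 2 (s≤s (s≤s z≤n)) exponent ⟩
  2 ^ (2 ^ j ∸ 1)               ∎)
  where
  open ℕ.≤-Reasoning
  a = 2 + t
  j = 2 * a
  exponent : suc (j * t) < 2 ^ j ∸ 1
  exponent = ℕ.m+n≤o⇒m≤o∸n _ (begin
    suc (suc (j * t)) + 1       ≤⟨ ℕ.m≤m+n _ (13 + 2 * t * t + 12 * t) ⟩
    suc (suc (j * t)) + 1 + (13 + 2 * t * t + 12 * t) ≡⟨ expand t ⟩
    (2 * a) * (2 * a)           ≤⟨ ℕ.*-mono-≤ (2n≤2^n a (s≤s z≤n)) (2n≤2^n a (s≤s z≤n)) ⟩
    2 ^ a * 2 ^ a               ≡⟨ ℕ.^-distribˡ-+-* 2 a a ⟨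
    2 ^ (a + a)                 ≡⟨ cong (λ x → 2 ^ (a + x)) (ℕ.+-identityʳ a) ⟨
    2 ^ j                       ∎)
    where
    expand : ∀ t → suc (suc (2 * (2 + t) * t)) + 1 + (13 + 2 * t * t + 12 * t) ≡ (2 * (2 + t)) * (2 * (2 + t))
    expand = ℕ-solve-∀

-- Close primes, or sparse residue classes

record ClosePrimes (p m X : ℕ) : Set where
  field
    {q e}   : ℕ
    X≤q     : X ≤ q
    prime-q : Prime q
    prime-r : Prime (q + e * p)
    {{e≢0}} : NonZero e
    close   : m * e * p < q

module _ (p m X N : ℕ) .{{_ : NonZero p}} where

  Covers : ℕ → ℕ → List ℕ → Set
  Covers u y B = ∀ {x n} → Prime x → x % p ≡ u → y ≤ x → 1 ≤ n → n ≤ N → x ∣ n → n ∈ B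

  -- Absence of close primes makes the primes of a residue class grow like (1 + 1/m)^i, and
  -- then Σ N/qᵢ over the class is at most (m + 1) N / q₁.
  data Sparse (u y : ℕ) : Set where
    none  : Covers u y [] → Sparse u y
    chain : ∀ {q₁ B} → Prime q₁ → q₁ % p ≡ u → y ≤ q₁ → Covers u y B → length B * q₁ ≤ suc m * N → Sparse u y

  multiples : ∀ y → .{{NonZero y}} → List ℕ
  multiples y = map (λ i → suc i * y) (upTo (N / y))

  ∈-multiples : ∀ {y n} .{{_ : NonZero y}} → 1 ≤ n → n ≤ N → y ∣ n → n ∈ multiples y
  ∈-multiples {y} 1≤n n≤N (divides (suc k) refl) = ∈-map⁺ (λ i → suc i * y) (∈-upTo⁺
    (ℕ.≤-trans (ℕ.≤-reflexive (sym (m*n/n≡m (suc k) y))) (/-monoˡ-≤ y n≤N)))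
  ∈-multiples 1≤n n≤N (divides zero refl) with () ← 1≤n

  length-multiples : ∀ y .{{_ : NonZero y}} → length (multiples y) * y ≤ N
  length-multiples y = ℕ.≤-trans (ℕ.≤-reflexive (cong (_* y)
    (trans (List.length-map _ (upTo (N / y))) (List.length-upTo (N / y))))) (m/n*n≤m N y)

  same-residue : ∀ {y q₁} → y % p ≡ q₁ % p → y < q₁ → ∃ λ e → NonZero e × q₁ ≡ y + e * p
  same-residue {y} {q₁} y≡q₁ y<q₁ = e , ℕ.≢-nonZero (λ e≡0 → ℕ.<⇒≢ y<q₁ (sym (trans q₁≡ (trans (cong (λ e → y + e * p) e≡0) (ℕ.+-identityʳ y))))) , q₁≡
    where
    e = q₁ / p ∸ y / p
    open ≡-Reasoning
    q₁≡ : q₁ ≡ y + e * p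
    q₁≡ = begin
      q₁                                     ≡⟨ m≡m%n+[m/n]*n q₁ p ⟩
      q₁ % p + q₁ / p * p                    ≡⟨ cong₂ (λ u k → u + k * p) (sym y≡q₁) (sym (ℕ.m+[n∸m]≡n (/-monoˡ-≤ p (ℕ.<⇒≤ y<q₁)))) ⟩
      y % p + (y / p + e) * p                ≡⟨ shuffle (y % p) (y / p) e p ⟩
      y % p + y / p * p + e * p              ≡⟨ cong (_+ e * p) (m≡m%n+[m/n]*n y p) ⟨
      y + e * p                              ∎
      where
      shuffle : ∀ u k e p → u + (k + e) * p ≡ u + k * p + e * p
      shuffle = ℕ-solve-∀

  extend : ∀ {u y} → X ≤ y → Prime y → y % p ≡ u → Sparse u (suc y) → ClosePrimes p m X ⊎ Sparse u y
  extend {u} {y} X≤y py y%p (none cover) = inj₂ (chain py y%p ℕ.≤-refl cover′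
    (ℕ.≤-trans (length-multiples y) (ℕ.m≤n*m N (suc m))))
    where
    instance _ = prime⇒nonZero py
    cover′ : Covers u y (multiples y)
    cover′ px x%p y≤x 1≤n n≤N x∣n with ℕ.m≤n⇒m<n∨m≡n y≤x
    ... | inj₁ y<x  = contradiction (cover px x%p y<x 1≤n n≤N x∣n) λ ()
    ... | inj₂ refl = ∈-multiples 1≤n n≤N x∣n
  extend {u} {y} X≤y py y%p (chain {q₁} {B} pq₁ q₁%p y<q₁ cover bound) with same-residue (trans y%p (sym q₁%p)) y<q₁
  ... | e , e≢0 , refl with m * e * p ℕ.<? y
  ... | yes close = inj₁ (record { X≤q = X≤y ; prime-q = py ; prime-r = pq₁ ; e≢0 = e≢0 ; close = close })
  ... | no ¬close = inj₂ (chain py y%p ℕ.≤-refl cover′ bound′)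
    where
    instance _ = prime⇒nonZero py
    cover′ : Covers u y (multiples y ++ B)
    cover′ px x%p y≤x 1≤n n≤N x∣n with ℕ.m≤n⇒m<n∨m≡n y≤x
    ... | inj₁ y<x  = ∈-++⁺ʳ (multiples y) (cover px x%p y<x 1≤n n≤N x∣n)
    ... | inj₂ refl = ∈-++⁺ˡ (∈-multiples 1≤n n≤N x∣n)
    open ℕ.≤-Reasoning
    -- If the next prime q₁ = y + ep of the class is not close, then y ≤ mep, that is (m + 1)y ≤ m
    -- q₁. So the bound (m + 1)N for B at q₁ drops to mN at y, which leaves room for the at most N/y
    -- multiples of y.
    tail : length B * y ≤ m * N
    tail = ℕ.*-cancelˡ-≤ (suc m) (begin
      suc m * (length B * y)             ≡⟨ shuffle m (length B) y ⟩
      length B * (y + m * y)             ≤⟨ ℕ.*-monoʳ-≤ (length B) (ℕ.+-monoˡ-≤ (m * y) (ℕ.≮⇒≥ ¬close)) ⟩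
      length B * (m * e * p + m * y)     ≡⟨ shuffle′ m (length B) y e p ⟩
      m * (length B * (y + e * p))       ≤⟨ ℕ.*-monoʳ-≤ m bound ⟩
      m * (suc m * N)                    ≡⟨ shuffle″ m N ⟩
      suc m * (m * N)                    ∎)
      where
      shuffle : ∀ m b y → suc m * (b * y) ≡ b * (y + m * y)
      shuffle = ℕ-solve-∀
      shuffle′ : ∀ m b y e p → b * (m * e * p + m * y) ≡ m * (b * (y + e * p))
      shuffle′ = ℕ-solve-∀
      shuffle″ : ∀ m N → m * (suc m * N) ≡ suc m * (m * N)
      shuffle″ = ℕ-solve-∀
    bound′ : length (multiples y ++ B) * y ≤ suc m * N
    bound′ = begin
      length (multiples y ++ B) * y                  ≡⟨ cong (_* y) (List.length-++ (multiples y)) ⟩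
      (length (multiples y) + length B) * y          ≡⟨ ℕ.*-distribʳ-+ y (length (multiples y)) (length B) ⟩
      length (multiples y) * y + length B * y        ≤⟨ ℕ.+-mono-≤ (length-multiples y) tail ⟩
      N + m * N                                      ∎

  skip : ∀ {u y B} → ¬ (Prime y × y % p ≡ u) → Covers u (suc y) B → Covers u y B
  skip ¬y cover px x%p y≤x = cover px x%p (ℕ.≤∧≢⇒< y≤x λ { refl → ¬y (px , x%p) })

  -- The class is scanned downwards from N + 1, so each new prime lies below all those already in
  -- the chain. Primes above N have no multiples to cover.
  scan : ∀ u k y → y + k ≡ suc N → X ≤ y → ClosePrimes p m X ⊎ Sparse u y
  scan u zero    y eq X≤y = inj₂ (none λ { {x} {suc n} _ _ y≤x _ n≤N x∣n → contradiction
    (ℕ.≤-trans (ℕ.≤-reflexive (trans (sym eq) (ℕ.+-identityʳ y))) (ℕ.≤-trans y≤x (ℕ.≤-trans (∣⇒≤ x∣n) n≤N))) (ℕ.<-irrefl refl) })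
  scan u (suc k) y eq X≤y with scan u k (suc y) (trans (sym (ℕ.+-suc y k)) eq) (ℕ.m≤n⇒m≤1+n X≤y)
  ... | inj₁ close  = inj₁ close
  ... | inj₂ sparse with prime? y ×-dec (y % p ℕ.≟ u)
  ...   | yes (py , y%p) = extend X≤y py y%p sparse
  ...   | no ¬y with sparse
  ...     | none cover = inj₂ (none (skip ¬y cover))
  ...     | chain pq₁ q₁%p y<q₁ cover bound = inj₂ (chain pq₁ q₁%p (ℕ.<⇒≤ y<q₁) (skip ¬y cover) bound)

  module _ (X≤1+N : X ≤ suc N) where

    scan-class : ∀ u → ClosePrimes p m X ⊎ ∃ λ B → Covers u X B × length B * X ≤ suc m * N
    scan-class u with scan u (suc N ∸ X) X (ℕ.m+[n∸m]≡n X≤1+N) ℕ.≤-refl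
    ... | inj₁ close                          = inj₁ close
    ... | inj₂ (none cover)                   = inj₂ ([] , cover , z≤n)
    ... | inj₂ (chain {B = B} _ _ X≤q₁ cover bound) = inj₂ (B , cover , ℕ.≤-trans (ℕ.*-monoʳ-≤ (length B) X≤q₁) bound)

    -- Used with t = p, when the classes exhaust all primes: either some class contains close
    -- primes, or one list covers the multiples of all primes ≥ X.
    scan-classes : ∀ t → ClosePrimes p m X ⊎
      ∃ λ B → (∀ {u} → u < t → Covers u X B) × length B * X ≤ t * (suc m * N)
    scan-classes zero    = inj₂ ([] , (λ ()) , z≤n)
    scan-classes (suc t) with scan-classes t | scan-class t
    ... | inj₁ close | _          = inj₁ close
    ... | inj₂ _     | inj₁ close = inj₁ close
    ... | inj₂ (B , cover , bound) | inj₂ (B′ , cover′ , bound′) = inj₂ (B′ ++ B , both , total)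
      where
      both : ∀ {u} → u < suc t → Covers u X (B′ ++ B)
      both (s≤s u≤t) px x%p X≤x 1≤n n≤N x∣n with ℕ.m≤n⇒m<n∨m≡n u≤t
      ... | inj₁ u<t  = ∈-++⁺ʳ B′ (cover u<t px x%p X≤x 1≤n n≤N x∣n)
      ... | inj₂ refl = ∈-++⁺ˡ (cover′ px x%p X≤x 1≤n n≤N x∣n)
      total : length (B′ ++ B) * X ≤ suc t * (suc m * N)
      total = ℕ.≤-trans (ℕ.≤-reflexive (trans (cong (_* X) (List.length-++ B′)) (ℕ.*-distribʳ-+ X (length B′) (length B))))
        (ℕ.+-mono-≤ bound′ bound)

-- Erdős: if close primes did not exist, the multiples of primes ≥ X would fill at most half
-- of 1, …, 2ⁿ, and the X-smooth numbers cannot fill the other half.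
module _ (p m X n : ℕ) .{{_ : NonZero p}} (2pm≤X : 2 * (p * suc m) ≤ X) (small : 2 * suc n ^ X < 2 ^ n) where

  private
    1≤X : 1 ≤ X
    1≤X = ℕ.≤-trans (ℕ.*-mono-≤ {1} {2} (s≤s z≤n) (ℕ.*-mono-≤ (ℕ.>-nonZero⁻¹ p) (s≤s {0} {m} z≤n))) 2pm≤X

    X≤N : X ≤ 2 ^ n
    X≤N = begin
      X                   ≤⟨ ℕ.m≤n*m X 2 ⟩
      2 * X               ≤⟨ 2n≤2^n X 1≤X ⟩
      2 ^ X               ≤⟨ ℕ.^-monoˡ-≤ X (s≤s (1≤n n small)) ⟩
      suc n ^ X           ≤⟨ ℕ.m≤n*m _ 2 ⟩
      2 * suc n ^ X       ≤⟨ ℕ.<⇒≤ small ⟩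
      2 ^ n               ∎
      where
      open ℕ.≤-Reasoning
      1≤n : ∀ n → 2 * suc n ^ X < 2 ^ n → 1 ≤ n
      1≤n zero    small = contradiction small (ℕ.≤⇒≯ (ℕ.≤-trans (ℕ.≤-reflexive (sym (ℕ.^-zeroˡ X))) (ℕ.m≤n*m (1 ^ X) 2)))
      1≤n (suc n) _     = s≤s z≤n

    not-all-sparse : ∀ B → (∀ {u} → u < p → Covers p m X (2 ^ n) u X B) → ¬ length B * X ≤ p * (suc m * 2 ^ n)
    not-all-sparse B cover bound = contradiction full (ℕ.<⇒≱ sparse)
      where
      full : 2 ^ n ≤ length (smooth X n ++ B)
      full = length-covering (2 ^ n) _ covered
        where
        covered : ∀ {x} → 1 ≤ x → x ≤ 2 ^ n → x ∈ smooth X n ++ B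
        covered {x} 1≤x x≤ with ℕ.anyUpTo? (λ d → prime? d ×-dec (X ℕ.≤? d) ×-dec (d ∣? x)) (suc x)
        ... | yes (d , _ , pd , X≤d , d∣x) = ∈-++⁺ʳ (smooth X n) (cover (m%n<n d p) pd refl X≤d 1≤x x≤ d∣x)
        ... | no ¬big = ∈-++⁺ˡ (smooth-complete X n 1≤x x≤ λ {d} pd d∣x → ℕ.≰⇒> λ X≤d →
          ¬big (d , s≤s (∣⇒≤ {{ℕ.>-nonZero 1≤x}} d∣x) , pd , X≤d , d∣x))
      open ℕ.≤-Reasoning
      -- The p classes contribute at most (m + 1) 2^n / X entries each; the threshold 2p(m + 1) for
      -- X is chosen to make the total at most half.
      half : length B * 2 ≤ 2 ^ n
      half = ℕ.*-cancelʳ-≤ _ _ (p * suc m) {{ℕ.m*n≢0 p (suc m)}} (begin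
        length B * 2 * (p * suc m)     ≡⟨ ℕ.*-assoc (length B) 2 (p * suc m) ⟩
        length B * (2 * (p * suc m))   ≤⟨ ℕ.*-monoʳ-≤ (length B) 2pm≤X ⟩
        length B * X                   ≤⟨ bound ⟩
        p * (suc m * 2 ^ n)            ≡⟨ trans (sym (ℕ.*-assoc p (suc m) (2 ^ n))) (ℕ.*-comm (p * suc m) (2 ^ n)) ⟩
        2 ^ n * (p * suc m)            ∎)
      sparse : length (smooth X n ++ B) < 2 ^ n
      sparse = ℕ.*-cancelʳ-< 2 _ _ (begin-strict
        length (smooth X n ++ B) * 2              ≡⟨ trans (cong (_* 2) (List.length-++ (smooth X n))) (ℕ.*-distribʳ-+ 2 (length (smooth X n)) (length B)) ⟩
        length (smooth X n) * 2 + length B * 2    ≤⟨ ℕ.+-monoˡ-≤ _ (ℕ.*-monoˡ-≤ 2 (length-smooth X n)) ⟩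
        suc n ^ X * 2 + length B * 2              ≡⟨ cong (_+ length B * 2) (ℕ.*-comm (suc n ^ X) 2) ⟩
        2 * suc n ^ X + length B * 2              <⟨ ℕ.+-mono-<-≤ small half ⟩
        2 ^ n + 2 ^ n                             ≡⟨ trans (cong (2 ^ n +_) (sym (ℕ.+-identityʳ (2 ^ n)))) (ℕ.*-comm 2 (2 ^ n)) ⟩
        2 ^ n * 2                                 ∎)

  closePrimes-below : ClosePrimes p m X
  closePrimes-below = fromInj₁ (λ (B , cover , bound) → contradiction bound (not-all-sparse B cover))
    (scan-classes p m X (2 ^ n) (ℕ.m≤n⇒m≤1+n X≤N) p)

-- Abstract, because the search must never be run by the type checker.
abstract
  closePrimes : ∀ p .{{_ : NonZero p}} m X → 2 * (p * suc m) ≤ X → ClosePrimes p m X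
  closePrimes p m X 2pm≤X = let n , small = exponential>polynomial X in closePrimes-below p m X n 2pm≤X small

-- The coefficients ±m

inverse : ∀ {p q} → Coprime q p → 2 ≤ p → ∃ λ w → ∃ λ v → w * q ≡ 1 + v * p
inverse {p} {q} cop 2≤p with coprime-Bézout cop
... | Bézout.Identity.+- x y eq = x , y , sym eq
-- Here xq ≡ -1 mod p, so x is multiplied by p - 1 ≡ -1.
inverse {suc (suc p″)} {q} cop (s≤s (s≤s z≤n)) | Bézout.Identity.-+ x (suc y) eq = p′ * x , y + p″ * suc y , ℕ.+-cancelʳ-≡ p′ _ _ (begin
    p′ * x * q + p′                              ≡⟨ factor p′ x q ⟩
    p′ * (1 + x * q)                             ≡⟨ cong (p′ *_) eq ⟩
    p′ * (suc y * suc p′)                        ≡⟨ expand p″ y ⟩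
    1 + (y + p″ * suc y) * suc p′ + p′           ∎)
  where
  p′ = suc p″
  open ≡-Reasoning
  factor : ∀ p x q → p * x * q + p ≡ p * (1 + x * q)
  factor = ℕ-solve-∀
  expand : ∀ p y → suc p * (suc y * suc (suc p)) ≡ 1 + (y + p * suc y) * suc (suc p) + suc p
  expand = ℕ-solve-∀

abstract
  inverse-< : ∀ {p q} → Coprime q p → 2 ≤ p → ∃ λ w → ∃ λ v → w < p × w * q ≡ 1 + v * p
  inverse-< {p@(suc _)} {q} cop 2≤p with w , v , eq ← inverse cop 2≤p =
    w % p , v ∸ w / p * q , m%n<n w p , ℕ.+-cancelʳ-≡ (w / p * q * p) _ _ (begin
      w % p * q + w / p * q * p                       ≡⟨ shuffle (w % p) (w / p) p q ⟩
      (w % p + w / p * p) * q                         ≡⟨ cong (_* q) (m≡m%n+[m/n]*n w p) ⟨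
      w * q                                           ≡⟨ eq ⟩
      1 + v * p                                       ≡⟨ cong (λ v → 1 + v * p) (ℕ.m∸n+n≡m small) ⟨
      1 + (v ∸ w / p * q + w / p * q) * p             ≡⟨ cong suc (ℕ.*-distribʳ-+ p (v ∸ w / p * q) (w / p * q)) ⟩
      1 + (v ∸ w / p * q) * p + w / p * q * p         ∎)
    where
    open ≡-Reasoning
    shuffle : ∀ a b p q → a * q + b * q * p ≡ (a + b * p) * q
    shuffle = ℕ-solve-∀
    small : w / p * q ≤ v
    small = ℕ.s≤s⁻¹ (ℕ.*-cancelʳ-< p _ _ (≤R.begin-strict
      w / p * q * p       ≤R.≡⟨ trans (ℕ.*-assoc (w / p) q p) (trans (cong (w / p *_) (ℕ.*-comm q p)) (sym (ℕ.*-assoc (w / p) p q))) ⟩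
      w / p * p * q       ≤R.≤⟨ ℕ.*-monoˡ-≤ q (m/n*n≤m w p) ⟩
      w * q               ≤R.≡⟨ eq ⟩
      1 + v * p           ≤R.<⟨ ℕ.+-monoˡ-< (v * p) 2≤p ⟩
      suc v * p           ≤R.∎))
      where module ≤R = ℕ.≤-Reasoning

double-< : ∀ {p q} → Prime p → 2 * p ≤ q → p < q
double-< {p} pp 2p≤q = ℕ.<-≤-trans (ℕ.m<m+n p (ℕ.≤-trans (ℕ.>-nonZero⁻¹ p {{prime⇒nonZero pp}}) (ℕ.m≤m+n p 0))) 2p≤q

-- The sign is left open because it depends on which of the two cases w falls into.
record Value (m : ℕ) : Set where
  field
    {p q r}  : ℕ
    prime-p  : Prime p
    prime-q  : Prime q
    prime-r  : Prime r
    p<q      : p < q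
    q<r      : q < r
    14≤p     : 14 ≤ p
    2p≤q     : 2 * p ≤ q
    k        : ℕ
    k<qr     : k < q * r
    value    : let open Triple prime-p prime-q prime-r p<q q<r 14≤p in
               coeff R k ≡ ℤ.+ m ⊎ coeff R k ≡ ℤ.- (ℤ.+ m)

module _ {p q w v e m : ℕ} .{{_ : NonZero e}} (pp : Prime p) (pq : Prime q) (pr : Prime (q + e * p))
  (X≤p : 14 + (m + m) ≤ p) (2p≤q : 2 * p ≤ q) (w<p : w < p) (wq≡1+vp : w * q ≡ 1 + v * p) (close : m * e * p < q) where

  private
    instance
      nzp = prime⇒nonZero pp
      nzq = prime⇒nonZero pq
    14≤p : 14 ≤ p
    14≤p = ℕ.≤-trans (ℕ.m≤m+n 14 (m + m)) X≤p
    p<q : p < q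
    p<q = double-< pp 2p≤q
    r : ℕ
    r = q + e * p
    q<r : q < r
    q<r = ℕ.m<m+n q (ℕ.>-nonZero⁻¹ (e * p) {{ℕ.m*n≢0 e p}})
    open Congruent {p} {q} {w} {v} {e} pp pq p<q wq≡1+vp w<p hiding (r; M)
    open Triple {p} {q} {r} pp pq pr p<q q<r 14≤p using (R; M; coeff-R)
    build : ∀ {k} → k < q * p → coeff R k ≡ ℤ.+ m ⊎ coeff R k ≡ ℤ.- (ℤ.+ m) → Value m
    build k<qp value = record
      { prime-p = pp ; prime-q = pq ; prime-r = pr ; p<q = p<q ; q<r = q<r ; 14≤p = 14≤p ; 2p≤q = 2p≤q
      ; k<qr = ℕ.<-trans k<qp (ℕ.*-monoʳ-< q (ℕ.<-trans p<q q<r)) ; value = value }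

  value-from : Value m
  value-from with w + m ℕ.<? p
  ... | yes w+m<p = build k<qp (inj₂ (begin
      coeff R k                                      ≡⟨ coeff-R q k<qp ⟩
      coeff (M q) k ℤ.- coeff (ℤ.0ℤ ∷ M q) k         ≡⟨ cong₂ ℤ._-_ (M-at close w+m<p) (trans (cong (coeff (ℤ.0ℤ ∷ M q)) k≡) (M-before close w+m<p)) ⟩
      ℤ.1ℤ ℤ.- ℤ.+ suc m                             ≡⟨ 1-1+m m ⟩
      ℤ.- (ℤ.+ m)                                    ∎))
    where
    open ≡-Reasoning
    k = (w + m) * q
    k<qp : k < q * p
    k<qp = ℕ.<-≤-trans (ℕ.*-monoˡ-< q w+m<p) (ℕ.≤-reflexive (ℕ.*-comm p q))
    k≡ : k ≡ suc (m * q + v * p)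
    k≡ = trans (ℕ.*-distribʳ-+ q w m) (trans (cong (_+ m * q) wq≡1+vp) (cong suc (ℕ.+-comm (v * p) (m * q))))
    1-1+m : ∀ m → ℤ.1ℤ ℤ.- ℤ.+ suc m ≡ ℤ.- (ℤ.+ m)
    1-1+m zero    = refl
    1-1+m (suc m) = refl
  ... | no w+m≮p = large m refl
    where
    large : ∀ m′ → m ≡ m′ → Value m
    large zero    m≡0   = contradiction (subst (_< p) (sym (trans (cong (w +_) m≡0) (ℕ.+-identityʳ w))) w<p) w+m≮p
    large (suc t) m≡1+t = build k<qp (inj₁ (begin
        coeff R (t * r)                                       ≡⟨ coeff-R q k<qp ⟩
        coeff (M q) (t * r) ℤ.- coeff (ℤ.0ℤ ∷ M q) (t * r)    ≡⟨ cong₂ ℤ._-_ (M-at′ close m≡1+t t<w) (previous (t * r) refl) ⟩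
        ℤ.+ suc t ℤ.- ℤ.0ℤ                                    ≡⟨ ℤ.+-identityʳ (ℤ.+ suc t) ⟩
        ℤ.+ suc t                                             ≡⟨ cong ℤ.+_ (sym m≡1+t) ⟩
        ℤ.+ m                                                 ∎))
      where
      open ≡-Reasoning
      t<w : t < w
      -- This is where p ≥ 2m enters: m + m ≤ p ≤ w + m.
      t<w = ℕ.≤-trans (ℕ.≤-reflexive (sym m≡1+t)) (ℕ.+-cancelʳ-≤ m m w
        (ℕ.≤-trans (ℕ.m≤n+m (m + m) 14) (ℕ.≤-trans X≤p (ℕ.≮⇒≥ w+m≮p))))
      -- For m = 1 the degree tr is 0, and the preceding coefficient is the zero prepended by the
      -- shift.
      previous : ∀ k → k ≡ t * r → coeff (ℤ.0ℤ ∷ M q) k ≡ ℤ.0ℤ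
      previous zero    _  = refl
      previous (suc j) eq = M-before′ close m≡1+t t<w eq
      k<qp : t * r < q * p
      k<qp = ≤R.begin-strict
        t * r                ≤R.≡⟨ trans (ℕ.*-distribˡ-+ t q (e * p)) (cong (t * q +_) (sym (ℕ.*-assoc t e p))) ⟩
        t * q + t * e * p    ≤R.<⟨ ℕ.+-monoʳ-< (t * q) (ℕ.≤-<-trans (ℕ.*-monoˡ-≤ p (ℕ.*-monoˡ-≤ e (ℕ.≤-trans (ℕ.n≤1+n t) (ℕ.≤-reflexive (sym m≡1+t))))) close) ⟩
        t * q + q            ≤R.≡⟨ ℕ.+-comm (t * q) q ⟩
        suc t * q            ≤R.≤⟨ ℕ.*-monoˡ-≤ q (ℕ.<-trans t<w w<p) ⟩
        p * q                ≤R.≡⟨ ℕ.*-comm p q ⟩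
        q * p                ≤R.∎
        where module ≤R = ℕ.≤-Reasoning

-- The threshold of the prime search thus also separates the two copies of R in Ψ_pqr.
2p≤ : ∀ {p m q} → 2 * (p * suc m) ≤ q → 2 * p ≤ q
2p≤ {p} {m} = ℕ.≤-trans (ℕ.*-monoʳ-≤ 2 (ℕ.m≤m*n p (suc m)))

value-from-close : ∀ {m p} (pp : Prime p) → 14 + (m + m) ≤ p → ClosePrimes p m (2 * (p * suc m)) → Value m
value-from-close {m} {p} pp X≤p C = from-inverse (inverse-< (prime⇒coprime prime-q pp (ℕ.>⇒≢ (double-< pp 2p≤q)))
                                                            (ℕ.≤-trans (s≤s (s≤s z≤n)) X≤p))
  where
  open ClosePrimes C
  2p≤q : 2 * p ≤ q
  2p≤q = 2p≤ {p} {m} X≤q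
  from-inverse : (∃ λ w → ∃ λ v → w < p × w * q ≡ 1 + v * p) → Value m
  from-inverse (w , v , w<p , wq≡1+vp) = value-from {v = v} pp prime-q prime-r X≤p 2p≤q w<p wq≡1+vp close

abstract
  -- The search is used twice. With modulus 1 and m = 0 closeness is no restriction, and it yields a
  -- prime of size at least 14 + 2m, which becomes p; the second search, modulo this p, yields q and
  -- r.
  value-exists : ∀ m → Value m
  value-exists m = value-from-close prime-q X≤q (closePrimes q {{prime⇒nonZero prime-q}} m _ ℕ.≤-refl)
    where open ClosePrimes (closePrimes 1 0 (14 + (m + m)) (s≤s (s≤s z≤n)))

both-signs : ∀ {m} (V : Value m) → let open Value V in
  (∃ λ k → c (p * q * r) k ≡ ℤ.+ m) × (∃ λ k → c (p * q * r) k ≡ ℤ.- (ℤ.+ m))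
both-signs {m} V with Value.value V
... | inj₁ R≡m  = (q * r + k , trans (c-high 2p≤q k) R≡m) , (k , trans (c-low k<qr) (cong ℤ.-_ R≡m))
  where
  open Value V
  open Triple prime-p prime-q prime-r p<q q<r 14≤p
... | inj₂ R≡-m = (k , trans (c-low k<qr) (trans (cong ℤ.-_ R≡-m) (ℤ.neg-involutive (ℤ.+ m)))) , (q * r + k , trans (c-high 2p≤q k) R≡-m)
  where
  open Value V
  open Triple prime-p prime-q prime-r p<q q<r 14≤p

theorem8 : (z : ℤ) → Σ ℕ λ p → Σ ℕ λ q → Σ ℕ λ r → Σ ℕ λ k →
    Prime p × Prime q × Prime r × 3 ≤ p × p < q × q < r × c (p * q * r) k ≡ z
theorem8 z = p , q , r , proj₁ (attained z refl) , prime-p , prime-q , prime-r ,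
  ℕ.≤-trans (s≤s (s≤s (s≤s z≤n))) 14≤p , p<q , q<r , proj₂ (attained z refl)
  where
  open Value (value-exists ℤ.∣ z ∣)
  -- Matching on a copy of z keeps p, q, r fixed by the absolute value while the sign decides
  -- between the two degrees.
  attained : ∀ y → y ≡ z → ∃ λ k → c (p * q * r) k ≡ z
  attained (ℤ.+ n)    refl = proj₁ (both-signs (value-exists ℤ.∣ z ∣))
  attained ℤ.-[1+ n ] refl = proj₂ (both-signs (value-exists ℤ.∣ z ∣))
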